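{- Consider three-colored partitions whose parts are of the form $k_a$, $k_b$, $k_c$ with $k\ge1$ a positive integer and $a,b,c$ colors, ordered $1_a<1_b<1_c<2_a<2_b<2_c<3_a<\cdots$. Let $\Lambda^\star$ be the set of such partitions that contain no pair of parts of the form $j_a$ and $j_b$, no pair $j_b$ and $j_c$, and no pair $j_c$ and $(j+1)_a$ (for any $j\ge1$). For $\lambda\in\Lambda^\star$ let $|\lambda|$ be the sum of the parts ignoring color (a part $k_x$ contributes $k$), and let $\#_a(\lambda)$, $\#_c(\lambda)$ be the numbers of parts of color $a$, resp. $c$. Then $$\sum_{\lambda\in\Lambda^\star}A^{\#_a(\lambda)}C^{\#_c(\lambda)}q^{|\lambda|}=\frac{1}{(q;q)_\infty\,(Aq;q^2)_\infty\,(Cq;q^2)_\infty}.$$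
   Context: $(a;q)_\infty=\prod_{j\ge0}(1-aq^j)$. A colored partition is a finite multiset of colored parts; parts may repeat. -}

module Defs where

open import Algebra.Bundles using (CommutativeRing)
import Algebra.Properties.Ring as RingProperties
import Algebra.Properties.Semiring.Exp as SemiringExp
import Algebra.Properties.Semiring.Sum as SemiringSum
open import Data.Fin.Base using (Fin; zero; suc; toℕ)
import Data.Fin.Properties as Fin
open import Data.List.Base as List using (List; []; _∷_; [_]; filter; length; foldr; upTo; cartesianProductWith)
open import Data.List.Membership.Propositional using (_∈_)
open import Data.List.Membership.Propositional.Properties using (∈-cartesianProductWith⁺; ∈-cartesianProductWith⁻; ∈-filter⁺; ∈-filter⁻; ∈-upTo⁺)
open import Data.List.Relation.Unary.All as All using (All; []; _∷_)
open import Data.List.Relation.Unary.AllPairs using ([]; _∷_)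
open import Data.List.Relation.Unary.Any using (here; there)
import Data.List.Relation.Unary.Sorted.TotalOrder as Sorting
open import Data.List.Relation.Unary.Unique.Propositional using (Unique)
import Data.List.Relation.Unary.Unique.Propositional.Properties as Unique
import Data.Nat.ListAction as ListAction
open import Data.Nat.Base as ℕ using (ℕ; zero; suc; _∸_; NonZero; z≤n; s≤s; s≤s⁻¹)
import Data.Nat.Properties as ℕ
open import Data.Product.Base using (_×_; _,_; proj₁; proj₂)
open import Data.Product.Relation.Binary.Lex.NonStrict using (×-decTotalOrder)
open import Function.Base using (_∘_)
open import Function.Bundles using (_⇔_; mk⇔)
open import Level using (Level; 0ℓ)
open import Relation.Binary.Bundles using (DecTotalOrder)
import Relation.Binary.Construct.On as On
open import Relation.Binary.Definitions using (DecidableEquality)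
open import Relation.Binary.PropositionalEquality as ≡ using (_≡_; refl)
import Relation.Binary.Reasoning.Setoid as SetoidReasoning
open import Relation.Nullary.Decidable using (Dec; yes; no; ¬?; _×-dec_; map′)
open import Relation.Nullary.Negation using (¬_)

data Color : Set where
  a b c : Color

_≟ᶜ_ : DecidableEquality Color
a ≟ᶜ a = yes refl
a ≟ᶜ b = no λ ()
a ≟ᶜ c = no λ ()
b ≟ᶜ a = no λ ()
b ≟ᶜ b = yes refl
b ≟ᶜ c = no λ ()
c ≟ᶜ a = no λ ()
c ≟ᶜ b = no λ ()
c ≟ᶜ c = yes refl

colorRank : Color → Fin 3
colorRank a = zero
colorRank b = suc zero
colorRank c = suc (suc zero)

record Part : Set where
  constructor part
  field
    size           : ℕ
    color          : Color
    .{{size-nonZero}} : NonZero size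

open Part public

-- 1_a < 1_b < 1_c < 2_a < 2_b < 2_c < 3_a < ⋯
partOrder : DecTotalOrder 0ℓ 0ℓ 0ℓ
partOrder = On.decTotalOrder
  (×-decTotalOrder ℕ.≤-decTotalOrder (Fin.≤-decTotalOrder 3))
  (λ (p : Part) → size p , colorRank (color p))

open Sorting (DecTotalOrder.totalOrder partOrder) using (Sorted; sorted?)

-- A finite multiset of parts is represented by the one list that has its parts
-- in weakly increasing order, so that propositional equality of the lists
-- satisfying IsPartition is equality of multisets.
IsPartition : List Part → Set
IsPartition = Sorted

∣_∣ : List Part → ℕ
∣ π ∣ = ListAction.sum (List.map size π)

#[_] : Color → List Part → ℕ
#[ x ] π = length (filter (λ p → color p ≟ᶜ x) π)

data Forbidden : Part → Part → Set where
  ab : ∀ j .{{_ : NonZero j}} → Forbidden (part j a) (part j b)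
  bc : ∀ j .{{_ : NonZero j}} → Forbidden (part j b) (part j c)
  ca : ∀ j .{{_ : NonZero j}} → Forbidden (part j c) (part (suc j) a)

record Λ⋆ (π : List Part) : Set where
  field
    isPartition  : IsPartition π
    noForbidden  : ∀ {p r} → p ∈ π → r ∈ π → ¬ Forbidden p r

forbidden? : ∀ p r → Dec (Forbidden p r)
forbidden? (part j a {{i}}) (part k b) = map′ (λ { refl → ab j {{i}} }) (λ { (ab _) → refl }) (j ℕ.≟ k)
forbidden? (part j b {{i}}) (part k c) = map′ (λ { refl → bc j {{i}} }) (λ { (bc _) → refl }) (j ℕ.≟ k)
forbidden? (part j c {{i}}) (part k a) = map′ (λ { refl → ca j {{i}} }) (λ { (ca _) → refl }) (suc j ℕ.≟ k)
forbidden? (part _ a) (part _ a) = no λ ()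
forbidden? (part _ a) (part _ c) = no λ ()
forbidden? (part _ b) (part _ a) = no λ ()
forbidden? (part _ b) (part _ b) = no λ ()
forbidden? (part _ c) (part _ b) = no λ ()
forbidden? (part _ c) (part _ c) = no λ ()

Λ⋆? : ∀ π → Dec (Λ⋆ π)
Λ⋆? π = map′
  (λ (s , f) → record
    { isPartition = s
    ; noForbidden = λ p∈π r∈π → All.lookup (All.lookup f p∈π) r∈π })
  (λ h → Λ⋆.isPartition h
       , All.tabulate λ p∈π → All.tabulate λ r∈π → Λ⋆.noForbidden h p∈π r∈π)
  (sorted? (DecTotalOrder._≤?_ partOrder) π
    ×-dec All.all? (λ p → All.all? (λ r → ¬? (forbidden? p r)) π) π)

record Enumeration {ℓ p} {X : Set ℓ} (P : X → Set p) : Set (ℓ Level.⊔ p) where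
  field
    elements : List X
    unique   : Unique elements
    correct  : ∀ x → x ∈ elements ⇔ P x

partsUpTo : ℕ → List Part
partsUpTo n = cartesianProductWith (λ i x → part (suc i) x) (upTo n) (a ∷ b ∷ c ∷ [])

listsUpTo : {X : Set} → List X → ℕ → List (List X)
listsUpTo xs zero    = [ [] ]
listsUpTo xs (suc k) = [] ∷ cartesianProductWith _∷_ xs (listsUpTo xs k)

partsUpTo-unique : ∀ n → Unique (partsUpTo n)
partsUpTo-unique n = Unique.cartesianProductWith⁺ _ (λ { refl → refl , refl }) (Unique.upTo⁺ n)
  (((λ ()) ∷ (λ ()) ∷ []) ∷ ((λ ()) ∷ []) ∷ [] ∷ [])

∈-partsUpTo : ∀ {n} p → size p ℕ.≤ n → p ∈ partsUpTo n
∈-partsUpTo (part (suc i) x) i<n = ∈-cartesianProductWith⁺ _ (∈-upTo⁺ i<n) (∈-colors x)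
  where
  ∈-colors : ∀ x → x ∈ a ∷ b ∷ c ∷ []
  ∈-colors a = here refl
  ∈-colors b = there (here refl)
  ∈-colors c = there (there (here refl))

listsUpTo-unique : {X : Set} {xs : List X} → Unique xs → ∀ k → Unique (listsUpTo xs k)
listsUpTo-unique u zero    = [] ∷ []
listsUpTo-unique {xs = xs} u (suc k) =
  All.tabulate []≢ ∷ Unique.cartesianProductWith⁺ _∷_ (λ { refl → refl , refl }) u (listsUpTo-unique u k)
  where
  []≢ : ∀ {ys} → ys ∈ cartesianProductWith _∷_ xs (listsUpTo xs k) → ¬ [] ≡ ys
  []≢ ys∈ refl with ∈-cartesianProductWith⁻ _∷_ xs (listsUpTo xs k) ys∈
  ... | _ , _ , _ , _ , ()

∈-listsUpTo : {X : Set} {xs : List X} → ∀ {k} ys → length ys ℕ.≤ k → All (_∈ xs) ys → ys ∈ listsUpTo xs k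
∈-listsUpTo {k = zero}  []       _ _ = here refl
∈-listsUpTo {k = suc k} []       _ _ = here refl
∈-listsUpTo {k = suc k} (y ∷ ys) l (y∈ ∷ ys∈) =
  there (∈-cartesianProductWith⁺ _∷_ y∈ (∈-listsUpTo ys (s≤s⁻¹ l) ys∈))

length≤∣∣ : ∀ π → length π ℕ.≤ ∣ π ∣
length≤∣∣ []                  = z≤n
length≤∣∣ (part (suc i) x ∷ π) = s≤s (ℕ.≤-trans (length≤∣∣ π) (ℕ.m≤n+m ∣ π ∣ i))

sizes≤∣∣ : ∀ π → All (λ p → size p ℕ.≤ ∣ π ∣) π
sizes≤∣∣ []      = []
sizes≤∣∣ (p ∷ π) = ℕ.m≤m+n (size p) ∣ π ∣
  ∷ All.map (λ h → ℕ.≤-trans h (ℕ.m≤n+m ∣ π ∣ (size p))) (sizes≤∣∣ π)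

Λ⋆-enumeration : ∀ n → Enumeration (λ π → Λ⋆ π × ∣ π ∣ ≡ n)
Λ⋆-enumeration n = record
  { elements = filter P? candidates
  ; unique   = Unique.filter⁺ P? (listsUpTo-unique (partsUpTo-unique n) n)
  ; correct  = λ π → mk⇔ (λ π∈ → proj₂ (∈-filter⁻ P? {xs = candidates} π∈))
                          (λ h → ∈-filter⁺ P? (complete π (proj₂ h)) h)
  }
  where
  candidates = listsUpTo (partsUpTo n) n
  P? = λ π → Λ⋆? π ×-dec (∣ π ∣ ℕ.≟ n)
  complete : ∀ π → ∣ π ∣ ≡ n → π ∈ candidates
  complete π refl = ∈-listsUpTo π (length≤∣∣ π) (All.map (λ {p} → ∈-partsUpTo p) (sizes≤∣∣ π))

-- Formal power series in q over R; f n is the coefficient of qⁿ.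
module PowerSeries {r ℓ : Level} (R : CommutativeRing r ℓ) where

  open CommutativeRing R renaming (refl to ≈-refl; sym to ≈-sym; trans to ≈-trans)
  open SemiringExp semiring using (_^_)
  open SemiringSum semiring

  Series : Set r
  Series = ℕ → Carrier

  infix  4 _≋_
  infixl 6 _⊖_
  infixl 7 _⊛_ _·_
  infixr 8 _↑_

  _≋_ : Series → Series → Set ℓ
  f ≋ g = ∀ n → f n ≈ g n

  1ₛ : Series
  1ₛ zero    = 1#
  1ₛ (suc _) = 0#

  q : Series
  q 1 = 1#
  q _ = 0#

  _⊖_ : Series → Series → Series
  (f ⊖ g) n = f n - g n

  _·_ : Carrier → Series → Series
  (x · f) n = x * f n

  _⊛_ : Series → Series → Series
  (f ⊛ g) n = ∑[ i < suc n ] (f (toℕ i) * g (n ∸ toℕ i))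

  _↑_ : Series → ℕ → Series
  f ↑ zero  = 1ₛ
  f ↑ suc k = f ⊛ f ↑ k

  -- ∏_{0 ≤ j < N} (1 − x yʲ)
  poch : Series → Series → ℕ → Series
  poch x y zero    = 1ₛ
  poch x y (suc N) = (1ₛ ⊖ x ⊛ y ↑ N) ⊛ poch x y N

  -- (x ; y)_∞, for y with zero constant term.  The coefficient of qⁿ is the
  -- same in all partial products with more than n factors (poch-limit below).
  ⟨_⨾_⟩∞ : Series → Series → Series
  ⟨ x ⨾ y ⟩∞ n = poch x y (suc n) n

  -- 1 / f = ∑_{k ≥ 0} (1 − f)ᵏ, for f with constant term 1; (1 − f)ᵏ does not
  -- contribute to the coefficient of qⁿ when k > n.  See 1/-inverse below.
  1/_ : Series → Series
  (1/ f) n = ∑[ k < suc n ] ((1ₛ ⊖ f) ↑ toℕ k) n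

  -- ∑_{π ∈ Λ⋆} A^{#a(π)} C^{#c(π)} q^{|π|}
  Λ⋆-series : Carrier → Carrier → Series
  Λ⋆-series A C n =
    foldr _+_ 0# (List.map (λ π → A ^ #[ a ] π * C ^ #[ c ] π)
                           (Enumeration.elements (Λ⋆-enumeration n)))

  open SetoidReasoning setoid
  open RingProperties ring using (-0#≈0#)

  x-0≈x : ∀ {x y} → y ≈ 0# → x - y ≈ x
  x-0≈x h = ≈-trans (+-congˡ (≈-trans (-‿cong h) -0#≈0#)) (+-identityʳ _)

  sum-zero : ∀ {n} (t : Fin n → Carrier) → (∀ i → t i ≈ 0#) → sum t ≈ 0#
  sum-zero {n} t h = ≈-trans (sum-cong-≋ h) (sum-replicate-zero n)

  ∑-cong : ∀ {n} (s t : Fin n → Carrier) → (∀ i → s i ≈ t i) → sum s ≈ sum t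
  ∑-cong s t h = sum-cong-≋ h

  ⊛-congʳ-≤ : ∀ f g h n → (∀ i → i ℕ.≤ n → f i ≈ g i) → (f ⊛ h) n ≈ (g ⊛ h) n
  ⊛-congʳ-≤ f g h n eq = ∑-cong {suc n} (λ i → f (toℕ i) * h (n ∸ toℕ i)) (λ i → g (toℕ i) * h (n ∸ toℕ i))
    λ i → *-congʳ (eq (toℕ i) (s≤s⁻¹ (Fin.toℕ<n i)))

  ⊛-identityˡ : ∀ f → 1ₛ ⊛ f ≋ f
  ⊛-identityˡ f n = begin
    1# * f n + _  ≈⟨ +-cong (*-identityˡ _) (sum-zero {n} (λ i → 0# * f (n ∸ suc (toℕ i))) λ i → zeroˡ _) ⟩
    f n + 0#      ≈⟨ +-identityʳ _ ⟩
    f n           ∎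

  ↑-vanish : ∀ y → y 0 ≈ 0# → ∀ N k → k ℕ.< N → (y ↑ N) k ≈ 0#
  ↑-vanish y y₀ (suc N) k k<N = sum-zero (λ i → y (toℕ i) * (y ↑ N) (k ∸ toℕ i)) term
    where
    term : ∀ (i : Fin (suc k)) → y (toℕ i) * (y ↑ N) (k ∸ toℕ i) ≈ 0#
    term zero    = ≈-trans (*-congʳ y₀) (zeroˡ _)
    term (suc i) = ≈-trans (*-congˡ (↑-vanish y y₀ N _ (lt k k<N i))) (zeroʳ _)
      where
      lt : ∀ k → k ℕ.< suc N → (i : Fin k) → k ∸ suc (toℕ i) ℕ.< N
      lt (suc k) (s≤s k<N) i = ℕ.≤-<-trans (ℕ.m∸n≤m k (toℕ i)) k<N

  ⊛-vanish : ∀ x g N → (∀ k → k ℕ.< N → g k ≈ 0#) → ∀ k → k ℕ.< N → (x ⊛ g) k ≈ 0#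
  ⊛-vanish x g N h k k<N = sum-zero {suc k} (λ i → x (toℕ i) * g (k ∸ toℕ i)) λ i →
    ≈-trans (*-congˡ (h _ (ℕ.≤-<-trans (ℕ.m∸n≤m k (toℕ i)) k<N))) (zeroʳ _)

  sum-extend : ∀ (t : ℕ → Carrier) {m n} → m ℕ.≤ n → (∀ k → m ℕ.≤ k → t k ≈ 0#) →
               ∑[ k < m ] t (toℕ k) ≈ ∑[ k < n ] t (toℕ k)
  sum-extend t {n = n} z≤n     h = ≈-sym (sum-zero {n} _ λ k → h _ z≤n)
  sum-extend t         (s≤s l) h = +-congˡ (sum-extend (t ∘ suc) l λ k m≤k → h _ (s≤s m≤k))

  telescope : ∀ (t : ℕ → Carrier) n → ∑[ k < n ] (t (toℕ k) - t (suc (toℕ k))) ≈ t 0 - t n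
  telescope t zero    = ≈-sym (-‿inverseʳ _)
  telescope t (suc n) = begin
    (t 0 - t 1) + _                  ≈⟨ +-congˡ (telescope (t ∘ suc) n) ⟩
    (t 0 - t 1) + (t 1 - t (suc n))  ≈⟨ +-assoc _ _ _ ⟩
    t 0 + (- t 1 + (t 1 - t (suc n))) ≈⟨ +-congˡ (+-assoc _ _ _) ⟨
    t 0 + ((- t 1 + t 1) - t (suc n)) ≈⟨ +-congˡ (+-congʳ (-‿inverseˡ _)) ⟩
    t 0 + (0# - t (suc n))           ≈⟨ +-congˡ (+-identityˡ _) ⟩
    t 0 - t (suc n)                  ∎

  complement : ∀ f g → f ⊛ g ≋ (λ n → g n - ((1ₛ ⊖ f) ⊛ g) n)
  complement f g n = begin
    (f ⊛ g) n                       ≈⟨ +-identityʳ _ ⟨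
    (f ⊛ g) n + 0#                  ≈⟨ +-congˡ (-‿inverseʳ _) ⟨
    (f ⊛ g) n + (hg - hg)           ≈⟨ +-assoc _ _ _ ⟨
    ((f ⊛ g) n + hg) - hg           ≈⟨ +-congʳ (∑-distrib-+ {suc n} (λ i → f (toℕ i) * g (n ∸ toℕ i)) (λ i → (1ₛ ⊖ f) (toℕ i) * g (n ∸ toℕ i))) ⟨
    ∑[ i < suc n ] (f (toℕ i) * g (n ∸ toℕ i) + (1ₛ ⊖ f) (toℕ i) * g (n ∸ toℕ i)) - hg
                                    ≈⟨ +-congʳ (∑-cong {suc n} (λ i → f (toℕ i) * g (n ∸ toℕ i) + (1ₛ ⊖ f) (toℕ i) * g (n ∸ toℕ i)) (λ i → 1ₛ (toℕ i) * g (n ∸ toℕ i))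
                                         λ i → ≈-trans (≈-sym (distribʳ _ _ _)) (*-congʳ (cancel (toℕ i)))) ⟩
    (1ₛ ⊛ g) n - hg                 ≈⟨ +-congʳ (⊛-identityˡ g n) ⟩
    g n - hg                        ∎
    where
    hg = ((1ₛ ⊖ f) ⊛ g) n
    cancel : ∀ i → f i + (1ₛ i - f i) ≈ 1ₛ i
    cancel i = begin
      f i + (1ₛ i - f i)  ≈⟨ +-comm _ _ ⟩
      (1ₛ i - f i) + f i  ≈⟨ +-assoc _ _ _ ⟩
      1ₛ i + (- f i + f i) ≈⟨ +-congˡ (-‿inverseˡ _) ⟩
      1ₛ i + 0#           ≈⟨ +-identityʳ _ ⟩
      1ₛ i                ∎

  poch-limit : ∀ x {y} → y 0 ≈ 0# → ∀ {n N} → n ℕ.< N → poch x y N n ≈ ⟨ x ⨾ y ⟩∞ n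
  poch-limit x {y} y₀ {n} n<N = go (ℕ.≤⇒≤′ n<N)
    where
    go : ∀ {N} → suc n ℕ.≤′ N → poch x y N n ≈ poch x y (suc n) n
    go (ℕ.≤′-reflexive refl) = ≈-refl
    go (ℕ.≤′-step {N} n<N)   = begin
      ((1ₛ ⊖ x ⊛ y ↑ N) ⊛ poch x y N) n
        ≈⟨ ⊛-congʳ-≤ (1ₛ ⊖ x ⊛ y ↑ N) 1ₛ (poch x y N) n (λ i i≤n → x-0≈x (⊛-vanish x (y ↑ N) N (↑-vanish y y₀ N) i
             (ℕ.≤-<-trans i≤n (ℕ.≤′⇒≤ n<N)))) ⟩
      (1ₛ ⊛ poch x y N) n    ≈⟨ ⊛-identityˡ (poch x y N) n ⟩
      poch x y N n           ≈⟨ go n<N ⟩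
      poch x y (suc n) n     ∎

  1/-inverse : ∀ f → f 0 ≈ 1# → f ⊛ 1/ f ≋ 1ₛ
  1/-inverse f f₀ n = begin
    ∑[ i < suc n ] (f (toℕ i) * (1/ f) (n ∸ toℕ i))
      ≈⟨ ∑-cong {suc n} (λ i → f (toℕ i) * (1/ f) (n ∸ toℕ i)) (λ i → f (toℕ i) * S i)
           (λ i → *-congˡ (sum-extend (λ k → (h ↑ k) (n ∸ toℕ i))
             (s≤s (ℕ.m∸n≤m n (toℕ i))) (λ k → ↑-vanish h h₀ k _))) ⟩
    ∑[ i < suc n ] (f (toℕ i) * S i)
      ≈⟨ ∑-cong {suc n} (λ i → f (toℕ i) * S i) (λ i → ∑[ k < suc n ] T i k)
           (λ i → *-distribˡ-sum {suc n} (f (toℕ i)) (λ k → (h ↑ toℕ k) (n ∸ toℕ i))) ⟩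
    ∑[ i < suc n ] ∑[ k < suc n ] T i k
      ≈⟨ ∑-comm {suc n} {suc n} T ⟩
    ∑[ k < suc n ] (f ⊛ h ↑ toℕ k) n
      ≈⟨ ∑-cong {suc n} (λ k → (f ⊛ h ↑ toℕ k) n) (λ k → (h ↑ toℕ k) n - (h ↑ suc (toℕ k)) n)
           (λ k → complement f (h ↑ toℕ k) n) ⟩
    ∑[ k < suc n ] ((h ↑ toℕ k) n - (h ↑ suc (toℕ k)) n)
      ≈⟨ telescope (λ k → (h ↑ k) n) (suc n) ⟩
    1ₛ n - (h ↑ suc n) n
      ≈⟨ x-0≈x (↑-vanish h h₀ (suc n) n ℕ.≤-refl) ⟩
    1ₛ n ∎
    where
    h = 1ₛ ⊖ f
    S : Fin (suc n) → Carrier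
    S i = ∑[ k < suc n ] (h ↑ toℕ k) (n ∸ toℕ i)
    T : Fin (suc n) → Fin (suc n) → Carrier
    T i k = f (toℕ i) * (h ↑ toℕ k) (n ∸ toℕ i)
    h₀ : h 0 ≈ 0#
    h₀ = ≈-trans (+-congˡ (-‿cong f₀)) (-‿inverseʳ 1#)

{-# OPTIONS --safe #-}

-- Order the possible parts as 1_a, 1_b, 1_c, 2_a, … and let x_i be the weight of
-- the i-th one.  An element of Λ⋆ is a multiset of parts no two of which are
-- neighbours in this order, so the generating function E of the partitions into
-- the parts with index in an interval obeys a three-term recurrence, and
-- E ∏ (1 − x_i) is a polynomial continuant.  Write T_k for the continuant of the
-- parts of size at most k, U_k for that of the first 3k + 1 parts, and
-- X_m = (Aq²; q²)_m (Cq²; q²)_m.  With Q = q^{k+1} the recurrence becomes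
--   T_{k+1} = (1 − Q) U_k + Q (1 − AQ) (1 − CQ) T_k,
--   U_{k+1} = T_{k+1} − A C q Q² (1 − Q) U_k,
-- and its solution is, with q-binomial coefficients,
--   T_k = ∑_j (A C q^{2k+1})^j [k+1; 2j] (q; q²)_j X_{k−j},
--   U_k = ∑_j (A C q^{2k+3})^j [k; 2j] (q; q²)_j X_{k−j}.
-- Hence T_k ≡ X_k modulo q^k, so that
--   (q; q)_∞ (Aq; q)_∞ (Cq; q)_∞ E = (Aq²; q²)_∞ (Cq²; q²)_∞,
-- and cancelling the even factors leaves the product formula.

module Submission where

open import Defs
open import Algebra.Bundles using (CommutativeRing)
import Algebra.Properties.AbelianGroup as AbelianGroupProperties
import Algebra.Properties.CommutativeSemigroup as CommutativeSemigroupProperties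
import Algebra.Properties.Ring as RingProperties
import Algebra.Properties.Semiring.Exp as SemiringExp
import Algebra.Properties.Semiring.Mult.TCOptimised as Multiplication
import Algebra.Properties.Semiring.Sum as SemiringSum
import Algebra.Solver.Ring
open import Algebra.Solver.Ring.AlmostCommutativeRing using (fromCommutativeRing; _-Raw-AlmostCommutative⟶_)
open import Data.Fin.Base using (toℕ)
import Data.Fin.Properties as Fin
open import Data.Integer.Base as ℤ using (ℤ; +_; -[1+_])
import Data.Integer.Properties as ℤ
open import Data.List.Base using (List; []; _∷_; [_]; _++_; map; foldr)
open import Data.List.Membership.Propositional using (_∈_)
open import Data.List.Membership.Propositional.Properties using (∈-++⁺ˡ; ∈-++⁺ʳ; ∈-++⁻; ∈-map⁺; ∈-map⁻)
open import Data.List.Membership.Propositional.Properties.WithK using (unique∧set⇒bag)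
open import Data.List.Relation.Binary.BagAndSetEquality using (∼bag⇒↭)
open import Data.List.Relation.Binary.Permutation.Propositional using (_↭_; ↭⇒↭ₛ′)
import Data.List.Relation.Binary.Permutation.Propositional.Properties as ↭
open import Data.List.Relation.Binary.Permutation.Setoid.Properties using (foldr-commMonoid)
open import Data.List.Relation.Unary.All as All using (All; []; _∷_)
open import Data.List.Relation.Unary.AllPairs as AllPairs using (AllPairs; []; _∷_)
open import Data.List.Relation.Unary.Any using (here; there)
open import Data.List.Relation.Unary.Sorted.TotalOrder.Properties using (AllPairs⇒Sorted; Sorted⇒AllPairs)
open import Data.List.Relation.Unary.Unique.Propositional using (Unique)
import Data.List.Relation.Unary.Unique.Propositional.Properties as Unique
open import Data.Maybe.Base as Maybe using (Maybe)
open import Data.Nat.Base as ℕ using (ℕ; zero; suc; _∸_; z≤n; s≤s; s≤s⁻¹)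
import Data.Nat.Properties as ℕ
open import Data.Nat.Tactic.RingSolver using (solve-∀)
open import Data.Product.Base using (_×_; _,_; proj₁; proj₂; ∃)
open import Data.Sum.Base using (_⊎_; inj₁; inj₂; [_,_]′)
open import Function.Base using (_∘_)
open import Function.Bundles using (_⇔_; mk⇔)
open import Function.Construct.Composition using (_⇔-∘_)
open import Function.Construct.Symmetry using (⇔-sym)
open import Relation.Binary.Bundles using (DecTotalOrder)
open import Relation.Binary.Definitions using (tri<; tri≈; tri>)
open import Relation.Binary.PropositionalEquality as ≡ using (_≡_; refl)
import Relation.Binary.Reasoning.Setoid as SetoidReasoning
open import Relation.Nullary.Decidable using (yes; no; dec⇒maybe)
open import Relation.Nullary.Negation using (¬_; contradiction)

-- Ring solver with integer coefficients

module IntegerCoefficients {r ℓ} (S : CommutativeRing r ℓ) where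

  open CommutativeRing S renaming (refl to ≈-refl; sym to ≈-sym; trans to ≈-trans)
  open RingProperties ring using (-0#≈0#; -‿distribˡ-*; -‿distribʳ-*; -‿involutive)
  open AbelianGroupProperties +-abelianGroup using (⁻¹-∙-comm)
  open Multiplication semiring renaming (_×_ to infixl 8 _×#_)
  open SetoidReasoning setoid

  fromℤ : ℤ → Carrier
  fromℤ (+ n)    = n ×# 1#
  fromℤ -[1+ n ] = - (suc n ×# 1#)

  fromℤ-neg : ∀ i → fromℤ (ℤ.- i) ≈ - fromℤ i
  fromℤ-neg (+ zero)  = ≈-sym -0#≈0#
  fromℤ-neg (+ suc n) = ≈-refl
  fromℤ-neg -[1+ n ]  = ≈-sym (-‿involutive _)

  fromℤ-⊖ : ∀ m n → fromℤ (m ℤ.⊖ n) ≈ m ×# 1# - n ×# 1#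
  fromℤ-⊖ zero    zero    = ≈-sym (-‿inverseʳ 0#)
  fromℤ-⊖ zero    (suc n) = ≈-sym (+-identityˡ _)
  fromℤ-⊖ (suc m) zero    = ≈-sym (≈-trans (+-congˡ -0#≈0#) (+-identityʳ _))
  fromℤ-⊖ (suc m) (suc n) = begin
    fromℤ (suc m ℤ.⊖ suc n)                ≡⟨ ≡.cong fromℤ (ℤ.[1+m]⊖[1+n]≡m⊖n m n) ⟩
    fromℤ (m ℤ.⊖ n)                        ≈⟨ fromℤ-⊖ m n ⟩
    m ×# 1# - n ×# 1#                        ≈⟨ +-congʳ (+-identityʳ _) ⟨
    (m ×# 1# + 0#) - n ×# 1#                 ≈⟨ +-congʳ (+-congˡ (-‿inverseʳ 1#)) ⟨
    (m ×# 1# + (1# - 1#)) - n ×# 1#          ≈⟨ +-congʳ (+-assoc _ _ _) ⟨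
    ((m ×# 1# + 1#) - 1#) - n ×# 1#          ≈⟨ +-assoc _ _ _ ⟩
    (m ×# 1# + 1#) + (- 1# - n ×# 1#)        ≈⟨ +-cong (+-comm _ _) (⁻¹-∙-comm _ _) ⟩
    (1# + m ×# 1#) - (1# + n ×# 1#)          ≈⟨ +-cong (1+× m 1#) (-‿cong (1+× n 1#)) ⟨
    suc m ×# 1# - suc n ×# 1#                ∎

  fromℤ-+ : ∀ i j → fromℤ (i ℤ.+ j) ≈ fromℤ i + fromℤ j
  fromℤ-+ (+ m)    (+ n)    = ×-homo-+ 1# m n
  fromℤ-+ (+ m)    -[1+ n ] = fromℤ-⊖ m (suc n)
  fromℤ-+ -[1+ m ] (+ n)    = ≈-trans (fromℤ-⊖ n (suc m)) (+-comm _ _)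
  fromℤ-+ -[1+ m ] -[1+ n ] = begin
    - (suc (suc (m ℕ.+ n)) ×# 1#)    ≡⟨ ≡.cong (λ k → - (suc k ×# 1#)) (ℕ.+-suc m n) ⟨
    - ((suc m ℕ.+ suc n) ×# 1#)      ≈⟨ -‿cong (×-homo-+ 1# (suc m) (suc n)) ⟩
    - (suc m ×# 1# + suc n ×# 1#)     ≈⟨ ⁻¹-∙-comm _ _ ⟨
    - (suc m ×# 1#) - (suc n ×# 1#)   ∎

  fromℤ-+* : ∀ m j → fromℤ (+ m ℤ.* j) ≈ m ×# 1# * fromℤ j
  fromℤ-+* m (+ n)    = ≈-trans (reflexive (≡.cong fromℤ (≡.sym (ℤ.pos-* m n)))) (×1-homo-* m n)
  fromℤ-+* m -[1+ n ] = begin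
    fromℤ (+ m ℤ.* -[1+ n ])         ≡⟨ ≡.cong fromℤ (ℤ.neg-distribʳ-* (+ m) (+ suc n)) ⟨
    fromℤ (ℤ.- (+ m ℤ.* + suc n))    ≈⟨ fromℤ-neg (+ m ℤ.* + suc n) ⟩
    - fromℤ (+ m ℤ.* + suc n)        ≈⟨ -‿cong (fromℤ-+* m (+ suc n)) ⟩
    - (m ×# 1# * suc n ×# 1#)          ≈⟨ -‿distribʳ-* _ _ ⟩
    m ×# 1# * - (suc n ×# 1#)          ∎

  fromℤ-* : ∀ i j → fromℤ (i ℤ.* j) ≈ fromℤ i * fromℤ j
  fromℤ-* (+ m)    j = fromℤ-+* m j
  fromℤ-* -[1+ m ] j = begin
    fromℤ (-[1+ m ] ℤ.* j)           ≡⟨ ≡.cong fromℤ (ℤ.neg-distribˡ-* (+ suc m) j) ⟨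
    fromℤ (ℤ.- (+ suc m ℤ.* j))      ≈⟨ fromℤ-neg (+ suc m ℤ.* j) ⟩
    - fromℤ (+ suc m ℤ.* j)          ≈⟨ -‿cong (fromℤ-+* (suc m) j) ⟩
    - (suc m ×# 1# * fromℤ j)         ≈⟨ -‿distribˡ-* _ _ ⟩
    - (suc m ×# 1#) * fromℤ j         ∎

  homomorphism : ℤ.+-*-rawRing -Raw-AlmostCommutative⟶ fromCommutativeRing S
  homomorphism = record
    { ⟦_⟧    = fromℤ
    ; +-homo = fromℤ-+
    ; *-homo = fromℤ-*
    ; -‿homo = fromℤ-neg
    ; 0-homo = ≈-refl
    ; 1-homo = ≈-refl
    }

  -- Normal forms have integer coefficients, so constants cancel in every commutative ring. Unequal
  -- integers give no verdict, since their images may still coincide.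
  fromℤ-≟ : ∀ i j → Maybe (fromℤ i ≈ fromℤ j)
  fromℤ-≟ i j = Maybe.map (λ i≡j → reflexive (≡.cong fromℤ i≡j)) (dec⇒maybe (i ℤ.≟ j))

  open Algebra.Solver.Ring ℤ.+-*-rawRing (fromCommutativeRing S) homomorphism fromℤ-≟
    public using (solve; _:=_; _:+_; _:*_; _:-_; :-_; con; Polynomial)

  :1 : ∀ {n} → Polynomial n
  :1 = con (+ 1)

-- q-binomial coefficients

module QBinomial {r ℓ} (S : CommutativeRing r ℓ) (q : CommutativeRing.Carrier S) where

  open CommutativeRing S hiding (zero) renaming (refl to ≈-refl; sym to ≈-sym; trans to ≈-trans)
  open SemiringExp semiring
  open SetoidReasoning setoid
  open IntegerCoefficients S

  binom : ℕ → ℕ → Carrier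
  binom n       zero    = 1#
  binom zero    (suc i) = 0#
  binom (suc n) (suc i) = binom n i + q ^ suc i * binom n (suc i)

  -- The truncation in n ∸ i is harmless: binom n i vanishes for i > n.
  shifted : ℕ → ℕ → Carrier
  shifted n i = q ^ (n ∸ i) * binom n i

  binom-vanish : ∀ n i → n ℕ.< i → binom n i ≈ 0#
  binom-vanish zero    (suc i) _         = ≈-refl
  binom-vanish (suc n) (suc i) (s≤s n<i) = begin
    binom n i + q ^ suc i * binom n (suc i)
      ≈⟨ +-cong (binom-vanish n i n<i) (*-congˡ (binom-vanish n (suc i) (ℕ.m<n⇒m<1+n n<i))) ⟩
    0# + q ^ suc i * 0#
      ≈⟨ ≈-trans (+-identityˡ _) (zeroʳ _) ⟩
    0# ∎

  shifted-vanish : ∀ n i → n ℕ.< i → shifted n i ≈ 0#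
  shifted-vanish n i n<i = ≈-trans (*-congˡ (binom-vanish n i n<i)) (zeroʳ _)

  -- For i < n the exponent n - i is one more than n - (i + 1). For i ≥ n the subtraction truncates,
  -- but then the binomial coefficient on both sides is zero.
  q^∸ : ∀ n i → q ^ (n ∸ i) * binom n (suc i) ≈ q * shifted n (suc i)
  q^∸ n i with i ℕ.<? n
  ... | yes i<n = ≈-trans (*-congʳ (^-congʳ q (≡.sym (ℕ.suc-pred (n ∸ i) {{ℕ.>-nonZero (ℕ.m<n⇒0<n∸m i<n)}}))))
                          (≈-trans (*-congʳ (*-congˡ (^-congʳ q (ℕ.pred[m∸n]≡m∸[1+n] n i)))) (*-assoc _ _ _))
  ... | no  i≮n = begin
    q ^ (n ∸ i) * binom n (suc i)  ≈⟨ *-congˡ (binom-vanish n (suc i) n<1+i) ⟩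
    q ^ (n ∸ i) * 0#               ≈⟨ ≈-trans (zeroʳ _) (≈-sym (zeroʳ _)) ⟩
    q * 0#                         ≈⟨ *-congˡ (shifted-vanish n (suc i) n<1+i) ⟨
    q * shifted n (suc i)          ∎
    where n<1+i = s≤s (ℕ.≮⇒≥ i≮n)

  q^*shifted : ∀ n i → q ^ i * shifted n i ≈ q ^ n * binom n i
  q^*shifted n i with i ℕ.≤? n
  ... | yes i≤n = begin
    q ^ i * (q ^ (n ∸ i) * binom n i)  ≈⟨ *-assoc _ _ _ ⟨
    q ^ i * q ^ (n ∸ i) * binom n i    ≈⟨ *-congʳ (^-homo-* q i (n ∸ i)) ⟨
    q ^ (i ℕ.+ (n ∸ i)) * binom n i    ≈⟨ *-congʳ (^-congʳ q (ℕ.m+[n∸m]≡n i≤n)) ⟩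
    q ^ n * binom n i                  ∎
  ... | no  i≰n = begin
    q ^ i * shifted n i                ≈⟨ *-congˡ (shifted-vanish n i n<i) ⟩
    q ^ i * 0#                         ≈⟨ ≈-trans (zeroʳ _) (≈-sym (zeroʳ _)) ⟩
    q ^ n * 0#                         ≈⟨ *-congˡ (binom-vanish n i n<i) ⟨
    q ^ n * binom n i                  ∎
    where n<i = ℕ.≰⇒> i≰n

  -- The mirror image of the Pascal rule that defines `binom`, with the power of q on the other
  -- term. Both terms of the defining rule are expanded by induction, and the four results regroup
  -- by the defining rule one row lower.
  binom-pascal : ∀ n i → binom (suc n) (suc i) ≈ shifted n i + binom n (suc i)
  binom-pascal zero    zero    = solve 1 (λ x → :1 :+ (x :* :1) :* con (+ 0) := :1 :* :1 :+ con (+ 0)) ≈-refl q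
  binom-pascal zero    (suc i) = ≈-trans (+-congˡ (zeroʳ _)) (≈-sym (+-congʳ (zeroʳ _)))
  binom-pascal (suc n) zero    = begin
    1# + q * 1# * binom (suc n) 1
      ≈⟨ +-congˡ (*-congˡ (binom-pascal n 0)) ⟩
    1# + q * 1# * (q ^ n * 1# + binom n 1)
      ≈⟨ solve 3 (λ q z x → :1 :+ q :* :1 :* (z :* :1 :+ x) := q :* z :* :1 :+ (:1 :+ q :* :1 :* x)) ≈-refl _ _ _ ⟩
    q ^ suc n * 1# + binom (suc n) 1 ∎
  binom-pascal (suc n) (suc i) = begin
    binom (suc n) (suc i) + q ^ (2 ℕ.+ i) * binom (suc n) (2 ℕ.+ i)
      ≈⟨ +-cong (binom-pascal n i) (*-congˡ (binom-pascal n (suc i))) ⟩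
    (shifted n i + binom n (suc i)) + q ^ (2 ℕ.+ i) * (shifted n (suc i) + binom n (2 ℕ.+ i))
      ≈⟨ solve 6 (λ q p g g′ x x′ → (g :+ x) :+ q :* p :* (g′ :+ x′)
                    := (g :+ p :* (q :* g′)) :+ (x :+ q :* p :* x′)) ≈-refl
           q (q ^ suc i) (shifted n i) (shifted n (suc i)) _ _ ⟩
    (shifted n i + q ^ suc i * (q * shifted n (suc i))) + binom (suc n) (2 ℕ.+ i)
      ≈⟨ +-congʳ (+-congˡ (*-congˡ (q^∸ n i))) ⟨
    (q ^ (n ∸ i) * binom n i + q ^ suc i * (q ^ (n ∸ i) * binom n (suc i))) + binom (suc n) (2 ℕ.+ i)
      ≈⟨ +-congʳ (solve 4 (λ y p x x′ → y :* x :+ p :* (y :* x′) := y :* (x :+ p :* x′)) ≈-refl _ _ _ _) ⟩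
    shifted (suc n) (suc i) + binom (suc n) (2 ℕ.+ i) ∎

  -- The q-analogue of (i + 1) C(n + 1, i + 1) = (n + 1) C(n, i). In the inductive step the mirrored
  -- Pascal rule expands one coefficient, the hypothesis rewrites the other, and `q^*shifted`
  -- produces the power of q that makes 1 - q^{n+2} a common factor.
  binom-absorb : ∀ n i → (1# - q ^ suc i) * binom (suc n) (suc i) ≈ (1# - q ^ suc n) * binom n i
  binom-absorb zero    zero    = solve 1 (λ q → (:1 :- q :* :1) :* (:1 :+ q :* :1 :* con (+ 0))
                                        := (:1 :- q :* :1) :* :1) ≈-refl q
  binom-absorb zero    (suc i) = solve 2 (λ q p → (:1 :- p) :* (con (+ 0) :+ p :* con (+ 0))
                                        := (:1 :- q :* :1) :* con (+ 0)) ≈-refl q _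
  binom-absorb (suc n) zero    = begin
    (1# - q * 1#) * (1# + q * 1# * binom (suc n) 1)
      ≈⟨ solve 2 (λ q x → (:1 :- q :* :1) :* (:1 :+ q :* :1 :* x)
                    := (:1 :- q) :+ q :* ((:1 :- q :* :1) :* x)) ≈-refl _ _ ⟩
    (1# - q) + q * ((1# - q * 1#) * binom (suc n) 1)
      ≈⟨ +-congˡ (*-congˡ (binom-absorb n zero)) ⟩
    (1# - q) + q * ((1# - q ^ suc n) * 1#)
      ≈⟨ solve 2 (λ q y → (:1 :- q) :+ q :* ((:1 :- y) :* :1) := (:1 :- q :* y) :* :1) ≈-refl _ _ ⟩
    (1# - q ^ (2 ℕ.+ n)) * 1# ∎
  binom-absorb (suc n) (suc i) = begin
    (1# - q * p) * (binom (suc n) (suc i) + q * p * binom (suc n) (2 ℕ.+ i))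
      ≈⟨ solve 4 (λ q p x y → (:1 :- q :* p) :* (x :+ q :* p :* y)
                    := (:1 :- q :* p) :* x :+ q :* p :* ((:1 :- q :* p) :* y))
           ≈-refl q p (binom (suc n) (suc i)) (binom (suc n) (2 ℕ.+ i)) ⟩
    (1# - q * p) * binom (suc n) (suc i) + q * p * ((1# - q * p) * binom (suc n) (2 ℕ.+ i))
      ≈⟨ +-cong (*-congˡ (binom-pascal n i)) (*-congˡ (binom-absorb n (suc i))) ⟩
    (1# - q * p) * (shifted n i + binom n (suc i)) + q * p * ((1# - q * q ^ n) * binom n (suc i))
      ≈⟨ solve 5 (λ q u g x y → (:1 :- q :* (q :* u)) :* (g :+ x) :+ q :* (q :* u) :* ((:1 :- q :* y) :* x)
                   := (g :+ x) :- q :* (q :* (u :* g) :+ (q :* u) :* (q :* y) :* x))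
           ≈-refl q (q ^ i) (shifted n i) (binom n (suc i)) (q ^ n) ⟩
    (shifted n i + binom n (suc i)) - q * (q * (q ^ i * shifted n i) + p * (q * q ^ n) * binom n (suc i))
      ≈⟨ +-cong (≈-sym (binom-pascal n i)) (-‿cong (*-congˡ (+-congʳ (*-congˡ (q^*shifted n i))))) ⟩
    binom (suc n) (suc i) - q * (q * (q ^ n * binom n i) + p * (q * q ^ n) * binom n (suc i))
      ≈⟨ solve 5 (λ q p x y z → (x :+ p :* y) :- q :* (q :* (z :* x) :+ p :* (q :* z) :* y)
                    := (:1 :- q :* (q :* z)) :* (x :+ p :* y))
           ≈-refl q p (binom n i) (binom n (suc i)) (q ^ n) ⟩
    (1# - q ^ (2 ℕ.+ n)) * binom (suc n) (suc i) ∎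
    where p = q ^ suc i

  -- The difference of the two Pascal rules for `binom (suc n) (suc i)`.
  binom-shifted : ∀ n i → binom n i - shifted n i ≈ (1# - q ^ suc i) * binom n (suc i)
  binom-shifted n i = begin
    x - g                                ≈⟨ solve 4 (λ x g y p → x :- g
                                        := (x :+ p :* y) :- (g :+ y) :+ (:1 :- p) :* y)
                                              ≈-refl x g y (q ^ suc i) ⟩
    (x + q ^ suc i * y) - (g + y) + (1# - q ^ suc i) * y
                                         ≈⟨ +-congʳ (+-congˡ (-‿cong (binom-pascal n i))) ⟨
    (x + q ^ suc i * y) - (x + q ^ suc i * y) + (1# - q ^ suc i) * y
                                         ≈⟨ +-congʳ (-‿inverseʳ _) ⟩
    0# + (1# - q ^ suc i) * y            ≈⟨ +-identityˡ _ ⟩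
    (1# - q ^ suc i) * y                 ∎
    where
    x = binom n i
    g = shifted n i
    y = binom n (suc i)

-- The closed form of the continuants

module ClosedForm {r ℓ} (S : CommutativeRing r ℓ) (q A C : CommutativeRing.Carrier S) where

  open CommutativeRing S hiding (zero) renaming (refl to ≈-refl; sym to ≈-sym; trans to ≈-trans)
  open SemiringExp semiring
  open SemiringSum semiring
  open SetoidReasoning setoid
  open IntegerCoefficients S
  open QBinomial S q
  open PowerSeries S using (telescope; sum-extend; x-0≈x)

  T U : ℕ → Carrier
  T zero    = 1#
  T (suc k) = (1# - Q) * U k + Q * ((1# - A * Q) * (1# - C * Q)) * T k
    where Q = q ^ suc k
  U zero    = 1#
  U (suc k) = T (suc k) - A * C * (q * (Q * Q)) * (1# - Q) * U k
    where Q = q ^ suc k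

  X : ℕ → Carrier
  X zero    = 1#
  X (suc m) = (1# - A * q ^ (suc m ℕ.* 2)) * (1# - C * q ^ (suc m ℕ.* 2)) * X m

  -- (q; q²)_j
  odd : ℕ → Carrier
  odd zero    = 1#
  odd (suc j) = (1# - q ^ suc (j ℕ.* 2)) * odd j

  z : ℕ → Carrier
  z k = A * C * (q * (q ^ k * q ^ k))

  -- The truncation in `k ∸ j` is harmless: j > k gives 2j > k + 1, where the binomial coefficients
  -- vanish.
  t u : ℕ → ℕ → Carrier
  t k j = z k ^ j * (binom (suc k) (j ℕ.* 2) * odd j * X (k ∸ j))
  u k j = z (suc k) ^ j * (binom k (j ℕ.* 2) * odd j * X (k ∸ j))

  -- The error terms of the recurrence for T taken summand by summand; they telescope in j.
  rest : ℕ → ℕ → Carrier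
  rest k zero    = 0#
  rest k (suc j) = z (suc k) ^ suc j * (shifted (suc k) (suc (j ℕ.* 2)) * odd (suc j) * X (k ∸ j))

  z^-suc : ∀ k j → z (suc k) ^ j ≈ z k ^ j * q ^ (j ℕ.* 2)
  z^-suc k zero    = ≈-sym (*-identityˡ _)
  z^-suc k (suc j) = begin
    z (suc k) * z (suc k) ^ j
      ≈⟨ *-congˡ (z^-suc k j) ⟩
    A * C * (q * (q * y * (q * y))) * (z k ^ j * q ^ (j ℕ.* 2))
      ≈⟨ solve 5 (λ e q y w p → e :* (q :* (q :* y :* (q :* y))) :* (w :* p)
                    := e :* (q :* (y :* y)) :* w :* (q :* (q :* p)))
           ≈-refl (A * C) q y (z k ^ j) (q ^ (j ℕ.* 2)) ⟩
    z k * z k ^ j * (q * (q * q ^ (j ℕ.* 2))) ∎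
    where y = q ^ k

  -- The new factors of X carry q^{2(k+1-j)}. Writing this as p y², with p = q^{2j} and y =
  -- q^{k+1-2j}, puts it in the same two variables as Q = p y, as the polynomial identity in
  -- `shift-X` requires.
  X-suc : ∀ k j → j ℕ.* 2 ℕ.≤ suc k →
          let R = q ^ (j ℕ.* 2) * (q ^ (suc k ∸ j ℕ.* 2) * q ^ (suc k ∸ j ℕ.* 2)) in
          X (suc k ∸ j) ≈ (1# - A * R) * (1# - C * R) * X (k ∸ j)
  X-suc k j 2j≤1+k = begin
    X (suc k ∸ j)      ≡⟨ ≡.cong X (ℕ.+-∸-assoc 1 j≤k) ⟩
    X (suc (k ∸ j))    ≈⟨ *-congʳ (*-cong (+-congˡ (-‿cong (*-congˡ R≈))) (+-congˡ (-‿cong (*-congˡ R≈)))) ⟩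
    _                  ∎
    where
    halve : ∀ j k → j ℕ.* 2 ℕ.≤ suc k → j ℕ.≤ k
    halve zero    k       _             = z≤n
    halve (suc j) (suc k) (s≤s (s≤s h)) = s≤s (ℕ.≤-trans (ℕ.m≤m*n j 2) h)
    j≤k = halve j k 2j≤1+k

    m = suc k ∸ j ℕ.* 2
    exponent : suc (k ∸ j) ℕ.* 2 ≡ j ℕ.* 2 ℕ.+ (m ℕ.+ m)
    exponent = ℕ.+-cancelʳ-≡ (j ℕ.* 2) _ _ (≡.trans (≡.sym (ℕ.*-distribʳ-+ 2 (suc (k ∸ j)) j))
      (≡.trans (≡.cong (λ i → suc i ℕ.* 2) (ℕ.m∸n+n≡m j≤k))
      (≡.trans (≡.cong (ℕ._* 2) (≡.sym (ℕ.m∸n+n≡m 2j≤1+k))) (lemma m (j ℕ.* 2)))))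
      where
      lemma : ∀ m p → (m ℕ.+ p) ℕ.* 2 ≡ p ℕ.+ (m ℕ.+ m) ℕ.+ p
      lemma = solve-∀
    R≈ : q ^ (suc (k ∸ j) ℕ.* 2) ≈ q ^ (j ℕ.* 2) * (q ^ m * q ^ m)
    R≈ = ≈-trans (^-congʳ q exponent) (≈-trans (^-homo-* q (j ℕ.* 2) (m ℕ.+ m)) (*-congˡ (^-homo-* q m m)))

  -- Trades the factor (1 − AQ)(1 − CQ) for the factor that leads from X (k ∸ j) to
  -- X (suc k ∸ j), by eliminating A + C between the two.
  shift-X : ∀ k j → let Q = q ^ suc k; p = q ^ (j ℕ.* 2); B = binom (suc k) (j ℕ.* 2); G = shifted (suc k) (j ℕ.* 2) in
    Q * ((1# - A * Q) * (1# - C * Q)) * (B * X (k ∸ j))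
      ≈ p * (B * X (suc k ∸ j)) + (p - A * C * (Q * (Q * Q))) * ((G - B) * X (k ∸ j))
  shift-X k j with j ℕ.* 2 ℕ.≤? suc k
  -- For 2j > k + 1 the coefficients `B` and `G` are both zero, and so are both sides.
  ... | no  h = begin
    v * (B * x)                    ≈⟨ *-congˡ (*-congʳ B≈0) ⟩
    v * (0# * x)                   ≈⟨ solve 5 (λ v x p x′ w → v :* (con (+ 0) :* x)
                                        := p :* (con (+ 0) :* x′) :+ w :* ((con (+ 0) :- con (+ 0)) :* x))
                                        ≈-refl v x p (X (suc k ∸ j)) w ⟩
    p * (0# * X (suc k ∸ j)) + w * ((0# - 0#) * x)
                                   ≈⟨ +-cong (*-congˡ (*-congʳ B≈0)) (*-congˡ (*-congʳ (+-cong G≈0 (-‿cong B≈0)))) ⟨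
    _                              ∎
    where
    Q = q ^ suc k
    v = Q * ((1# - A * Q) * (1# - C * Q))
    p = q ^ (j ℕ.* 2)
    w = p - A * C * (Q * (Q * Q))
    x = X (k ∸ j)
    B = binom (suc k) (j ℕ.* 2)
    B≈0 = binom-vanish (suc k) (j ℕ.* 2) (ℕ.≰⇒> h)
    G≈0 = shifted-vanish (suc k) (j ℕ.* 2) (ℕ.≰⇒> h)
  ... | yes h = begin
    Q * ((1# - A * Q) * (1# - C * Q)) * (B * x)
      ≈⟨ *-congʳ (*-cong Q≈ (*-cong (+-congˡ (-‿cong (*-congˡ Q≈))) (+-congˡ (-‿cong (*-congˡ Q≈))))) ⟩
    p * y * ((1# - A * (p * y)) * (1# - C * (p * y))) * (B * x)
      -- Once Q is replaced by p y, and since `G` is y B by definition, the claim is an identity of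
      -- polynomials.
      ≈⟨ solve 6 (λ α κ p y b₀ x →
           p :* y :* ((:1 :- α :* (p :* y)) :* (:1 :- κ :* (p :* y))) :* (b₀ :* x)
           := p :* (b₀ :* ((:1 :- α :* (p :* (y :* y))) :* (:1 :- κ :* (p :* (y :* y))) :* x))
              :+ (p :- α :* κ :* (p :* y :* (p :* y :* (p :* y)))) :* ((y :* b₀ :- b₀) :* x))
           ≈-refl A C p y B x ⟩
    p * (B * ((1# - A * (p * (y * y))) * (1# - C * (p * (y * y))) * x))
      + (p - A * C * (p * y * (p * y * (p * y)))) * ((y * B - B) * x)
      ≈⟨ +-cong (*-congˡ (*-congˡ (X-suc k j h))) (*-congʳ (+-congˡ (-‿cong (*-congˡ (*-cong Q≈ (*-cong Q≈ Q≈)))))) ⟨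
    _ ∎
    where
    Q = q ^ suc k
    p = q ^ (j ℕ.* 2)
    y = q ^ (suc k ∸ j ℕ.* 2)
    x = X (k ∸ j)
    B = binom (suc k) (j ℕ.* 2)
    Q≈ : Q ≈ p * y
    Q≈ = ≈-trans (^-congʳ q (≡.sym (ℕ.m+[n∸m]≡n h))) (^-homo-* q (j ℕ.* 2) _)

  -- The mirrored Pascal rule splits the binomial coefficient of `t (suc k) j`, and its shifted part
  -- is `rest k j`. At j = 0 the coefficient is 1 in every row, so there is no rest.
  t-suc : ∀ k j → t (suc k) j ≈ z (suc k) ^ j * (binom (suc k) (j ℕ.* 2) * odd j * X (suc k ∸ j)) + rest k j
  t-suc k zero    = ≈-sym (+-identityʳ _)
  t-suc k (suc j) = begin
    w * (binom (2 ℕ.+ k) (2 ℕ.+ j ℕ.* 2) * o * x)  ≈⟨ *-congˡ (*-congʳ (*-congʳ (binom-pascal (suc k) (suc (j ℕ.* 2))))) ⟩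
    w * ((G + B) * o * x)                          ≈⟨ solve 5 (λ w G B o x → w :* ((G :+ B) :* o :* x)
                                        := w :* (B :* o :* x) :+ w :* (G :* o :* x))
                                                        ≈-refl w G B o x ⟩
    w * (B * o * x) + w * (G * o * x)              ∎
    where
    w = z (suc k) ^ suc j
    G = shifted (suc k) (suc (j ℕ.* 2))
    B = binom (suc k) (2 ℕ.+ j ℕ.* 2)
    o = odd (suc j)
    x = X (k ∸ j)

  -- By absorption (1 - Q) [k; 2j] is B - G, which cancels the part p (G - B) that `shift-X` brings
  -- in. The surviving multiple of A C Q³ (B - G) is the next error term.
  u-t : ∀ k j → let Q = q ^ suc k in
    (1# - Q) * u k j + Q * ((1# - A * Q) * (1# - C * Q)) * t k j
      ≈ z (suc k) ^ j * (binom (suc k) (j ℕ.* 2) * odd j * X (suc k ∸ j)) + rest k (suc j)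
  u-t k j = begin
    (1# - Q) * (w′ * (b₀ * o * x)) + Q * ((1# - A * Q) * (1# - C * Q)) * (w * (B * o * x))
      ≈⟨ solve 8 (λ Q w′ b₀ o x v w B → (:1 :- Q) :* (w′ :* (b₀ :* o :* x)) :+ v :* (w :* (B :* o :* x))
                    := w′ :* (((:1 :- Q) :* b₀) :* o :* x) :+ w :* o :* (v :* (B :* x)))
           ≈-refl Q w′ b₀ o x (Q * ((1# - A * Q) * (1# - C * Q))) w B ⟩
    w′ * (((1# - Q) * b₀) * o * x) + w * o * (Q * ((1# - A * Q) * (1# - C * Q)) * (B * x))
      ≈⟨ +-cong (*-cong (z^-suc k j) (*-congʳ (*-congʳ [1-Q]b₀≈))) (*-congˡ (shift-X k j)) ⟩
    w * p * ((B - G) * o * x) + w * o * (p * (B * x⁺) + (p - A * C * (Q * (Q * Q))) * ((G - B) * x))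
      ≈⟨ solve 9 (λ w p B G o x x⁺ e Q → w :* p :* ((B :- G) :* o :* x) :+ w :* o :* (p :* (B :* x⁺) :+ (p :- e :* (Q :* (Q :* Q))) :* ((G :- B) :* x))
                    := w :* p :* (B :* o :* x⁺) :+ w :* e :* (Q :* Q) :* o :* x :* (Q :* (B :- G)))
           ≈-refl w p B G o x x⁺ (A * C) Q ⟩
    w * p * (B * o * x⁺) + w * (A * C) * (Q * Q) * o * x * (Q * (B - G))
      ≈⟨ +-congˡ (*-congˡ Q[B-G]≈) ⟩
    w * p * (B * o * x⁺) + w * (A * C) * (Q * Q) * o * x * ((1# - q * p) * (q * p * G′))
      ≈⟨ +-congˡ (solve 9 (λ w e Q o x q p G′ v → w :* e :* (Q :* Q) :* o :* x :* (v :* (q :* p :* G′))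
                    := e :* (q :* (Q :* Q)) :* (w :* p) :* (G′ :* (v :* o) :* x))
           ≈-refl w (A * C) Q o x q p G′ (1# - q * p)) ⟩
    w * p * (B * o * x⁺) + z (suc k) * (w * p) * (G′ * odd (suc j) * x)
      ≈⟨ +-cong (*-congʳ (z^-suc k j)) (*-congʳ (*-congˡ (z^-suc k j))) ⟨
    w′ * (B * o * x⁺) + rest k (suc j) ∎
    where
    Q  = q ^ suc k
    p  = q ^ (j ℕ.* 2)
    w  = z k ^ j
    w′ = z (suc k) ^ j
    b₀  = binom k (j ℕ.* 2)
    B  = binom (suc k) (j ℕ.* 2)
    G  = shifted (suc k) (j ℕ.* 2)
    B′ = binom (suc k) (suc (j ℕ.* 2))
    G′ = shifted (suc k) (suc (j ℕ.* 2))
    o  = odd j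
    x  = X (k ∸ j)
    x⁺ = X (suc k ∸ j)
    [1-Q]b₀≈ : (1# - Q) * b₀ ≈ B - G
    [1-Q]b₀≈ = ≈-trans (≈-sym (binom-absorb k (j ℕ.* 2))) (≈-sym (binom-shifted (suc k) (j ℕ.* 2)))
    Q[B-G]≈ : Q * (B - G) ≈ (1# - q * p) * (q * p * G′)
    Q[B-G]≈ = begin
      Q * (B - G)               ≈⟨ *-congˡ (binom-shifted (suc k) (j ℕ.* 2)) ⟩
      Q * ((1# - q * p) * B′)   ≈⟨ solve 3 (λ Q v B → Q :* (v :* B) := v :* (Q :* B)) ≈-refl _ _ _ ⟩
      (1# - q * p) * (Q * B′)   ≈⟨ *-congˡ (q^*shifted (suc k) (suc (j ℕ.* 2))) ⟨
      (1# - q * p) * (q * p * G′) ∎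

  -- The recurrence for U holds summand by summand once j is shifted by one. Here q^{2j+2} B is (D +
  -- q^{2j+2} B) - D: the bracket is the coefficient in `t (suc k) (suc j)` by the defining Pascal
  -- rule, and absorption turns (1 - q^{2j+1}) D into (1 - Q) [k; 2j].
  u-suc : ∀ k j → u (suc k) (suc j) ≈ t (suc k) (suc j) - z (suc k) * (1# - q ^ suc k) * u k j
  u-suc k j = begin
    z (2 ℕ.+ k) ^ suc j * (B * odd (suc j) * x)
      ≈⟨ *-congʳ (z^-suc (suc k) (suc j)) ⟩
    z₁ * w * (q * (q * p)) * (B * (v * o) * x)
      ≈⟨ solve 9 (λ z₁ w q p B v o x D → z₁ :* w :* (q :* (q :* p)) :* (B :* (v :* o) :* x)
                    := z₁ :* w :* ((D :+ q :* (q :* p) :* B) :* (v :* o) :* x) :- z₁ :* w :* o :* x :* (v :* D))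
           ≈-refl z₁ w q p B v o x D ⟩
    t (suc k) (suc j) - z₁ * w * o * x * (v * D)
      ≈⟨ +-congˡ (-‿cong (*-congˡ (binom-absorb k (j ℕ.* 2)))) ⟩
    t (suc k) (suc j) - z₁ * w * o * x * ((1# - q ^ suc k) * b₀)
      ≈⟨ +-congˡ (-‿cong (solve 6 (λ z₁ w o x y b₀ → z₁ :* w :* o :* x :* (y :* b₀)
                                     := z₁ :* y :* (w :* (b₀ :* o :* x)))
                          ≈-refl z₁ w o x (1# - q ^ suc k) b₀)) ⟩
    t (suc k) (suc j) - z₁ * (1# - q ^ suc k) * u k j ∎
    where
    z₁ = z (suc k)
    w  = z (suc k) ^ j
    p  = q ^ (j ℕ.* 2)
    B  = binom (suc k) (2 ℕ.+ j ℕ.* 2)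
    D  = binom (suc k) (suc (j ℕ.* 2))
    b₀  = binom k (j ℕ.* 2)
    v  = 1# - q ^ suc (j ℕ.* 2)
    o  = odd j
    x  = X (k ∸ j)

  -- The two formulas are proved together, because each recurrence involves both T and U.
  closed-form : ∀ k → T k ≈ ∑[ j < suc k ] t k (toℕ j) × U k ≈ ∑[ j < suc k ] u k (toℕ j)
  closed-form zero    = one , one
    where
    one : 1# ≈ 1# * (1# * 1# * 1#) + 0#
    one = solve 0 (:1 := :1 :* (:1 :* :1 :* :1) :+ con (+ 0)) ≈-refl
  closed-form (suc k) = T≈ , U≈
    where
    Q = q ^ suc k
    v = Q * ((1# - A * Q) * (1# - C * Q))
    N = 2 ℕ.+ k

    k<2j : ∀ {k j} → suc k ℕ.≤ j → suc k ℕ.< j ℕ.* 2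
    k<2j {j = suc j} (s≤s h) = s≤s (s≤s (ℕ.≤-trans h (ℕ.m≤m*n j 2)))

    zero-term : ∀ {B} w o x → B ≈ 0# → w * (B * o * x) ≈ 0#
    zero-term w o x h = ≈-trans (*-congˡ (*-congʳ (*-congʳ h))) (solve 3 (λ w o x → w :* (con (+ 0) :* o :* x)
                                        := con (+ 0)) ≈-refl w o x)

    t-vanish : ∀ j → suc k ℕ.≤ j → t k j ≈ 0#
    t-vanish j h = zero-term _ _ _ (binom-vanish (suc k) (j ℕ.* 2) (k<2j h))
    u-vanish : ∀ j → suc k ℕ.≤ j → u k j ≈ 0#
    u-vanish j h = zero-term _ _ _ (binom-vanish k (j ℕ.* 2) (ℕ.<-trans (ℕ.n<1+n k) (k<2j h)))
    rest-vanish : rest k N ≈ 0#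
    rest-vanish = zero-term _ _ _ (shifted-vanish (suc k) (suc (suc k ℕ.* 2)) (ℕ.m<n⇒m<1+n (k<2j ℕ.≤-refl)))

    -- `u-t` and `t-suc` share their main term, so only consecutive values of `rest` separate the
    -- two sides.
    step : ∀ j → (1# - Q) * u k j + v * t k j ≈ t (suc k) j - (rest k j - rest k (suc j))
    step j = ≈-trans (u-t k j) (≈-trans
      (solve 3 (λ m r r′ → m :+ r′ := (m :+ r) :- (r :- r′)) ≈-refl _ (rest k j) _)
      (+-congʳ (≈-sym (t-suc k j))))

    T≈ : T (suc k) ≈ ∑[ j < N ] t (suc k) (toℕ j)
    T≈ = begin
      (1# - Q) * U k + v * T k
        -- Both sums gain one zero term, which brings them to the length of the sum for k + 1.
        ≈⟨ +-cong (*-congˡ (≈-trans (proj₂ (closed-form k)) (sum-extend (u k) (ℕ.n≤1+n _) u-vanish)))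
                  (*-congˡ (≈-trans (proj₁ (closed-form k)) (sum-extend (t k) (ℕ.n≤1+n _) t-vanish))) ⟩
      (1# - Q) * (∑[ j < N ] u k (toℕ j)) + v * (∑[ j < N ] t k (toℕ j))
        ≈⟨ +-cong (*-distribˡ-sum {N} (1# - Q) (λ j → u k (toℕ j))) (*-distribˡ-sum {N} v (λ j → t k (toℕ j))) ⟩
      ∑[ j < N ] ((1# - Q) * u k (toℕ j)) + ∑[ j < N ] (v * t k (toℕ j))
        ≈⟨ ∑-distrib-+ {N} (λ j → (1# - Q) * u k (toℕ j)) (λ j → v * t k (toℕ j)) ⟨
      ∑[ j < N ] ((1# - Q) * u k (toℕ j) + v * t k (toℕ j))
        ≈⟨ +-identityʳ _ ⟨
      ∑[ j < N ] ((1# - Q) * u k (toℕ j) + v * t k (toℕ j)) + 0#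
        -- The added sum telescopes to zero: `rest k 0` is 0 by definition, and `rest k N` contains
        -- a vanishing binomial coefficient.
        ≈⟨ +-congˡ (≈-trans (telescope (rest k) N) (x-0≈x rest-vanish)) ⟨
      ∑[ j < N ] ((1# - Q) * u k (toℕ j) + v * t k (toℕ j)) + ∑[ j < N ] (rest k (toℕ j) - rest k (suc (toℕ j)))
        ≈⟨ ∑-distrib-+ {N} (λ j → (1# - Q) * u k (toℕ j) + v * t k (toℕ j)) (λ j → rest k (toℕ j) - rest k (suc (toℕ j))) ⟨
      ∑[ j < N ] (((1# - Q) * u k (toℕ j) + v * t k (toℕ j)) + (rest k (toℕ j) - rest k (suc (toℕ j))))
        ≈⟨ sum-cong-≋ {N} (λ j → ≈-trans (+-congʳ (step (toℕ j))) (solve 2 (λ m r → (m :- r) :+ r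
                             := m) ≈-refl (t (suc k) (toℕ j)) _)) ⟩
      ∑[ j < N ] t (suc k) (toℕ j) ∎

    y = z (suc k) * (1# - Q)
    U≈ : U (suc k) ≈ ∑[ j < N ] u (suc k) (toℕ j)
    U≈ = begin
      T (suc k) - y * U k
        ≈⟨ +-cong T≈ (≈-trans (-‿cong (*-congˡ (proj₂ (closed-form k))))
                         (solve 2 (λ y s → :- (y :* s)
                                        := :- y :* s) ≈-refl y _)) ⟩
      -- `t (suc k) 0` and `u (suc k) 0` are the same term, so only the terms with j > 0 take part
      -- in the subtraction.
      (t (suc k) 0 + ∑[ j < suc k ] t (suc k) (suc (toℕ j))) + - y * (∑[ j < suc k ] u k (toℕ j))
        ≈⟨ +-assoc _ _ _ ⟩
      t (suc k) 0 + (∑[ j < suc k ] t (suc k) (suc (toℕ j)) + - y * (∑[ j < suc k ] u k (toℕ j)))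
        ≈⟨ +-congˡ (+-congˡ (*-distribˡ-sum {suc k} (- y) (λ j → u k (toℕ j)))) ⟩
      t (suc k) 0 + (∑[ j < suc k ] t (suc k) (suc (toℕ j)) + ∑[ j < suc k ] (- y * u k (toℕ j)))
        ≈⟨ +-congˡ (∑-distrib-+ {suc k} (λ j → t (suc k) (suc (toℕ j))) (λ j → - y * u k (toℕ j))) ⟨
      t (suc k) 0 + ∑[ j < suc k ] (t (suc k) (suc (toℕ j)) + - y * u k (toℕ j))
        ≈⟨ +-congˡ (sum-cong-≋ {suc k} λ j → ≈-trans (u-suc k (toℕ j)) (+-congˡ (solve 2 (λ y s → :- (y :* s)
                                        := :- y :* s) ≈-refl y _))) ⟨
      ∑[ j < N ] u (suc k) (toℕ j) ∎

  -- The summand j = 0 of the closed form is X_k. Every other summand contains the factor `z k`, and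
  -- with it q^k.
  T≈X : ∀ k → ∃ λ e → T k ≈ X k + q ^ k * e
  T≈X k = e , (begin
    T k
      ≈⟨ proj₁ (closed-form k) ⟩
    1# * (1# * 1# * X k) + ∑[ j < k ] (z k * z k ^ toℕ j * s j)
      ≈⟨ +-cong (solve 1 (λ x → :1 :* (:1 :* :1 :* x) := x) ≈-refl (X k))
           (sum-cong-≋ {k} λ j → solve 5 (λ e q y w s → e :* (q :* (y :* y)) :* w :* s
                                        := y :* (e :* (q :* y) :* w :* s))
                                   ≈-refl (A * C) q (q ^ k) (z k ^ toℕ j) (s j)) ⟩
    X k + ∑[ j < k ] (q ^ k * d j)
      ≈⟨ +-congˡ (*-distribˡ-sum {k} (q ^ k) d) ⟨
    X k + q ^ k * e ∎)
    where
    s = λ j → binom (suc k) (suc (toℕ j) ℕ.* 2) * odd (suc (toℕ j)) * X (k ∸ suc (toℕ j))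
    d = λ j → A * C * (q * q ^ k) * z k ^ toℕ j * s j
    e = ∑[ j < k ] d j

-- The ring of power series

module SeriesRing {r ℓ} (R : CommutativeRing r ℓ) where

  open CommutativeRing R hiding (zero) renaming (refl to ≈-refl; sym to ≈-sym; trans to ≈-trans)
  open PowerSeries R
  open SetoidReasoning setoid

  infixl 6 _⊕_
  _⊕_ : Series → Series → Series
  (f ⊕ g) n = f n + g n

  0ₛ : Series
  0ₛ _ = 0#

  ⊝_ : Series → Series
  (⊝ f) n = - f n

  -- Agreement is assumed only up to qⁿ, because partial products and bounded part sizes will match
  -- their limits only that far.
  ⊛-cong-≤ : ∀ {f f′ g g′} n → (∀ i → i ℕ.≤ n → f i ≈ f′ i) → (∀ i → i ℕ.≤ n → g i ≈ g′ i) → (f ⊛ g) n ≈ (f′ ⊛ g′) n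
  ⊛-cong-≤ zero    f≈ g≈ = +-congʳ (*-cong (f≈ 0 z≤n) (g≈ 0 z≤n))
  ⊛-cong-≤ (suc n) f≈ g≈ = +-cong (*-cong (f≈ 0 z≤n) (g≈ (suc n) ℕ.≤-refl))
    (⊛-cong-≤ n (λ i i≤n → f≈ (suc i) (s≤s i≤n)) (λ i i≤n → g≈ i (ℕ.m≤n⇒m≤1+n i≤n)))

  ⊛-cong : ∀ {f f′ g g′} → f ≋ f′ → g ≋ g′ → f ⊛ g ≋ f′ ⊛ g′
  ⊛-cong f≋ g≋ n = ⊛-cong-≤ n (λ i _ → f≋ i) (λ i _ → g≋ i)

  -- Splits off the last term of the convolution, where the definition splits off the first.
  -- Comparing the two expansions gives commutativity by induction on the exponent.
  ⊛-suc : ∀ f g n → (f ⊛ g) (suc n) ≈ f (suc n) * g 0 + (f ⊛ (g ∘ suc)) n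
  ⊛-suc f g zero    = begin
    f 0 * g 1 + (f 1 * g 0 + 0#)    ≈⟨ +-comm _ _ ⟩
    (f 1 * g 0 + 0#) + f 0 * g 1    ≈⟨ +-assoc _ _ _ ⟩
    f 1 * g 0 + (0# + f 0 * g 1)    ≈⟨ +-congˡ (+-comm _ _) ⟩
    f 1 * g 0 + (f 0 * g 1 + 0#)    ∎
  ⊛-suc f g (suc n) = begin
    x + ((f ∘ suc) ⊛ g) (suc n)     ≈⟨ +-congˡ (⊛-suc (f ∘ suc) g n) ⟩
    x + (y + w)                     ≈⟨ +-assoc _ _ _ ⟨
    (x + y) + w                     ≈⟨ +-congʳ (+-comm _ _) ⟩
    (y + x) + w                     ≈⟨ +-assoc _ _ _ ⟩
    y + (x + w)                     ∎
    where
    x = f 0 * g (2 ℕ.+ n)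
    y = f (2 ℕ.+ n) * g 0
    w = ((f ∘ suc) ⊛ (g ∘ suc)) n

  ⊛-comm : ∀ f g → f ⊛ g ≋ g ⊛ f
  ⊛-comm f g zero    = +-congʳ (*-comm _ _)
  ⊛-comm f g (suc n) = ≈-trans (+-cong (*-comm _ _) (⊛-comm (f ∘ suc) g n)) (≈-sym (⊛-suc g f n))

  ⊛-distribʳ : ∀ h f g → (f ⊕ g) ⊛ h ≋ f ⊛ h ⊕ g ⊛ h
  ⊛-distribʳ h f g zero    = begin
    (f 0 + g 0) * h 0 + 0#                     ≈⟨ +-identityʳ _ ⟩
    (f 0 + g 0) * h 0                          ≈⟨ distribʳ _ _ _ ⟩
    f 0 * h 0 + g 0 * h 0                      ≈⟨ +-cong (+-identityʳ _) (+-identityʳ _) ⟨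
    (f 0 * h 0 + 0#) + (g 0 * h 0 + 0#)        ∎
  ⊛-distribʳ h f g (suc n) = begin
    (f 0 + g 0) * h (suc n) + ((f ⊕ g) ∘ suc ⊛ h) n   ≈⟨ +-cong (distribʳ _ _ _) (⊛-distribʳ h (f ∘ suc) (g ∘ suc) n) ⟩
    (x + y) + (x′ + y′)                               ≈⟨ interchange x y x′ y′ ⟩
    (x + x′) + (y + y′)                               ∎
    where
    open CommutativeSemigroupProperties +-commutativeSemigroup using (interchange)
    x = f 0 * h (suc n)
    y = g 0 * h (suc n)
    x′ = (f ∘ suc ⊛ h) n
    y′ = (g ∘ suc ⊛ h) n

  ⊛-distribˡ : ∀ h f g → h ⊛ (f ⊕ g) ≋ h ⊛ f ⊕ h ⊛ g
  ⊛-distribˡ h f g n = begin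
    (h ⊛ (f ⊕ g)) n           ≈⟨ ⊛-comm h (f ⊕ g) n ⟩
    ((f ⊕ g) ⊛ h) n           ≈⟨ ⊛-distribʳ h f g n ⟩
    (f ⊛ h) n + (g ⊛ h) n     ≈⟨ +-cong (⊛-comm f h n) (⊛-comm g h n) ⟩
    (h ⊛ f) n + (h ⊛ g) n     ∎

  ·-⊛ : ∀ x f g → (x · f) ⊛ g ≋ x · (f ⊛ g)
  ·-⊛ x f g zero    = ≈-trans (+-identityʳ _) (≈-trans (*-assoc _ _ _) (*-congˡ (≈-sym (+-identityʳ _))))
  ·-⊛ x f g (suc n) = ≈-trans (+-cong (*-assoc _ _ _) (·-⊛ x (f ∘ suc) g n)) (≈-sym (distribˡ _ _ _))

  ⊛-assoc : ∀ f g h → (f ⊛ g) ⊛ h ≋ f ⊛ (g ⊛ h)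
  ⊛-assoc f g h zero    = begin
    (f 0 * g 0 + 0#) * h 0 + 0#   ≈⟨ +-congʳ (*-congʳ (+-identityʳ _)) ⟩
    f 0 * g 0 * h 0 + 0#          ≈⟨ +-congʳ (*-assoc _ _ _) ⟩
    f 0 * (g 0 * h 0) + 0#        ≈⟨ +-congʳ (*-congˡ (+-identityʳ _)) ⟨
    f 0 * (g 0 * h 0 + 0#) + 0#   ∎
  ⊛-assoc f g h (suc n) = begin
    -- By computation, the tail of `f ⊛ g` is `f 0 · (g ∘ suc) ⊕ (f ∘ suc) ⊛ g`.
    (f 0 * g 0 + 0#) * h (suc n) + ((f 0 · (g ∘ suc) ⊕ (f ∘ suc) ⊛ g) ⊛ h) n
      ≈⟨ +-cong (≈-trans (*-congʳ (+-identityʳ _)) (*-assoc _ _ _)) (⊛-distribʳ h (f 0 · (g ∘ suc)) ((f ∘ suc) ⊛ g) n) ⟩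
    f 0 * (g 0 * h (suc n)) + (((f 0 · (g ∘ suc)) ⊛ h) n + ((f ∘ suc) ⊛ g ⊛ h) n)
      ≈⟨ +-congˡ (+-cong (·-⊛ (f 0) (g ∘ suc) h n) (⊛-assoc (f ∘ suc) g h n)) ⟩
    f 0 * (g 0 * h (suc n)) + (f 0 * ((g ∘ suc) ⊛ h) n + ((f ∘ suc) ⊛ (g ⊛ h)) n)
      ≈⟨ +-assoc _ _ _ ⟨
    (f 0 * (g 0 * h (suc n)) + f 0 * ((g ∘ suc) ⊛ h) n) + ((f ∘ suc) ⊛ (g ⊛ h)) n
      ≈⟨ +-congʳ (distribˡ _ _ _) ⟨
    (f ⊛ (g ⊛ h)) (suc n) ∎

  seriesRing : CommutativeRing r ℓ
  seriesRing = record
    { Carrier = Series ; _≈_ = _≋_ ; _+_ = _⊕_ ; _*_ = _⊛_ ; -_ = ⊝_ ; 0# = 0ₛ ; 1# = 1ₛ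
    ; isCommutativeRing = record
      { isRing = record
        { +-isAbelianGroup = record
          { isGroup = record
            { isMonoid = record
              { isSemigroup = record
                { isMagma = record
                  { isEquivalence = record
                    { refl  = λ _ → ≈-refl
                    ; sym   = λ f≋g n → ≈-sym (f≋g n)
                    ; trans = λ f≋g g≋h n → ≈-trans (f≋g n) (g≋h n)
                    }
                  ; ∙-cong = λ f≋ g≋ n → +-cong (f≋ n) (g≋ n)
                  }
                ; assoc = λ f g h n → +-assoc _ _ _
                }
              ; identity = (λ f n → +-identityˡ _) , (λ f n → +-identityʳ _)
              }
            ; inverse = (λ f n → -‿inverseˡ _) , (λ f n → -‿inverseʳ _)
            ; ⁻¹-cong = λ f≋g n → -‿cong (f≋g n)
            }
          ; comm = λ f g n → +-comm _ _
          }
        ; *-cong = ⊛-cong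
        ; *-assoc = ⊛-assoc
        ; *-identity = ⊛-identityˡ , λ f n → ≈-trans (⊛-comm f 1ₛ n) (⊛-identityˡ f n)
        ; distrib = ⊛-distribˡ , ⊛-distribʳ
        }
      ; *-comm = ⊛-comm
      }
    }

-- Continuants

module Continuant {r ℓ} (S : CommutativeRing r ℓ) (x : ℕ → CommutativeRing.Carrier S) where

  open CommutativeRing S hiding (zero) renaming (refl to ≈-refl; sym to ≈-sym; trans to ≈-trans)
  open SetoidReasoning setoid
  open IntegerCoefficients S

  -- The numerator of the generating function e(i, n) of multisets without neighbours and with
  -- indices in [i, i + n). It comes from e(i, n) = e(i + 1, n - 1) + x_i / (1 - x_i) e(i + 2, n -
  -- 2) by clearing the denominators.
  cont : ℕ → ℕ → Carrier
  cont i 0             = 1#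
  cont i 1             = 1#
  cont i (suc (suc n)) = (1# - x i) * cont (suc i) (suc n) + x i * (1# - x (suc i)) * cont (suc (suc i)) n

  -- Continuants can be expanded from either end. The right end is where the window grows from parts
  -- of size k to size k + 1. Expanding the left end first makes both terms smaller instances, with
  -- windows shorter by one and by two; hence two base cases.
  cont-snoc : ∀ i n → cont i (2 ℕ.+ n) ≈
              (1# - x (suc (n ℕ.+ i))) * cont i (suc n) + x (suc (n ℕ.+ i)) * (1# - x (n ℕ.+ i)) * cont i n
  cont-snoc i 0 = solve 2 (λ x y → (:1 :- x) :* :1 :+ x :* (:1 :- y) :* :1
                             := (:1 :- y) :* :1 :+ y :* (:1 :- x) :* :1)
                    ≈-refl (x i) (x (suc i))
  cont-snoc i 1 = solve 3 (λ x y z →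
      (:1 :- x) :* ((:1 :- y) :* :1 :+ y :* (:1 :- z) :* :1) :+ x :* (:1 :- y) :* :1
      := (:1 :- z) :* ((:1 :- x) :* :1 :+ x :* (:1 :- y) :* :1) :+ z :* (:1 :- y) :* :1)
    ≈-refl (x i) (x (suc i)) (x (2 ℕ.+ i))
  cont-snoc i (suc (suc n)) = begin
    (1# - x₀) * cont (suc i) (3 ℕ.+ n) + x₀ * (1# - x₁) * cont (2 ℕ.+ i) (2 ℕ.+ n)
      ≈⟨ +-cong (*-congˡ (cont-snoc (suc i) (suc n))) (*-congˡ (cont-snoc (2 ℕ.+ i) n)) ⟩
    (1# - x₀) * last (suc n ℕ.+ suc i) a₂ a₁ + x₀ * (1# - x₁) * last (n ℕ.+ (2 ℕ.+ i)) b₂ b₁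
      ≡⟨ ≡.cong₂ (λ k l → (1# - x₀) * last k a₂ a₁ + x₀ * (1# - x₁) * last l b₂ b₁)
           (≡.cong suc (ℕ.+-suc n i)) (≡.trans (ℕ.+-suc n (suc i)) (≡.cong suc (ℕ.+-suc n i))) ⟩
    (1# - x₀) * last m a₂ a₁ + x₀ * (1# - x₁) * last m b₂ b₁
      ≈⟨ solve 8 (λ x₀ u y v a₂ a₁ b₂ b₁ →
            (:1 :- x₀) :* ((:1 :- y) :* a₂ :+ y :* v :* a₁) :+ x₀ :* u :* ((:1 :- y) :* b₂ :+ y :* v :* b₁)
            := (:1 :- y) :* ((:1 :- x₀) :* a₂ :+ x₀ :* u :* b₂) :+ y :* v :* ((:1 :- x₀) :* a₁ :+ x₀ :* u :* b₁))
           ≈-refl x₀ (1# - x₁) (x (suc m)) (1# - x m) a₂ a₁ b₂ b₁ ⟩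
    last m (cont i (3 ℕ.+ n)) (cont i (2 ℕ.+ n)) ∎
    where
    m  = 2 ℕ.+ n ℕ.+ i
    x₀ = x i
    x₁ = x (suc i)
    a₁ = cont (suc i) (suc n)
    a₂ = cont (suc i) (2 ℕ.+ n)
    b₁ = cont (2 ℕ.+ i) n
    b₂ = cont (2 ℕ.+ i) (suc n)
    last : ℕ → Carrier → Carrier → Carrier
    last k g h = (1# - x (suc k)) * g + x (suc k) * (1# - x k) * h

  prod : ℕ → ℕ → Carrier
  prod i zero    = 1#
  prod i (suc n) = (1# - x i) * prod (suc i) n

  prod-snoc : ∀ i n → prod i (suc n) ≈ (1# - x (n ℕ.+ i)) * prod i n
  prod-snoc i zero    = ≈-refl
  prod-snoc i (suc n) = begin
    (1# - x i) * prod (suc i) (suc n)                     ≈⟨ *-congˡ (prod-snoc (suc i) n) ⟩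
    (1# - x i) * ((1# - x (n ℕ.+ suc i)) * prod (suc i) n) ≡⟨ ≡.cong (λ k → (1# - x i) * ((1# - x k) * prod (suc i) n)) (ℕ.+-suc n i) ⟩
    (1# - x i) * ((1# - x (suc n ℕ.+ i)) * prod (suc i) n) ≈⟨ solve 3 (λ u v p → u :* (v :* p)
                                        := v :* (u :* p)) ≈-refl _ _ _ ⟩
    (1# - x (suc n ℕ.+ i)) * prod i (suc n)               ∎

  -- `s i n` stands for the multisets with smallest index i and `e i n` for all multisets in the
  -- window. Removing one copy of the smallest part leaves either another multiset counted by
  -- `s i n` or one that starts no earlier than i + 2, so (1 - x_i) s = x_i e; multiplying by `prod`
  -- replaces division.
  prod*≈cont : (s e : ℕ → ℕ → Carrier) → (∀ i → e i 0 ≈ 1#) → (∀ i n → e i (suc n) ≈ s i n + e (suc i) n) →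
               (∀ i n → s i n ≈ x i * (s i n + e (2 ℕ.+ i) (n ∸ 1))) →
               ∀ i n → prod i n * e i n ≈ cont i n
  prod*≈cont s e e-zero e-suc s-rec = go
    where
    [1-x]s : ∀ i n → (1# - x i) * s i n ≈ x i * e (2 ℕ.+ i) (n ∸ 1)
    [1-x]s i n = begin
      (1# - x i) * s i n             ≈⟨ solve 2 (λ x s → (:1 :- x) :* s := s :- x :* s) ≈-refl (x i) (s i n) ⟩
      s i n - x i * s i n            ≈⟨ +-congʳ (s-rec i n) ⟩
      x i * (s i n + e (2 ℕ.+ i) (n ∸ 1)) - x i * s i n
                                     ≈⟨ solve 3 (λ x s e → x :* (s :+ e) :- x :* s
                                        := x :* e) ≈-refl (x i) (s i n) _ ⟩
      x i * e (2 ℕ.+ i) (n ∸ 1)      ∎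

    go : ∀ i n → prod i n * e i n ≈ cont i n
    go i 0 = ≈-trans (*-identityˡ _) (e-zero i)
    go i 1 = begin
      (1# - x i) * 1# * e i 1                       ≈⟨ *-cong (*-identityʳ _) (e-suc i 0) ⟩
      (1# - x i) * (s i 0 + e (suc i) 0)            ≈⟨ distribˡ _ _ _ ⟩
      (1# - x i) * s i 0 + (1# - x i) * e (suc i) 0 ≈⟨ +-cong ([1-x]s i 0) (*-congˡ (e-zero (suc i))) ⟩
      x i * e (2 ℕ.+ i) 0 + (1# - x i) * 1#         ≈⟨ +-congʳ (*-congˡ (e-zero (2 ℕ.+ i))) ⟩
      x i * 1# + (1# - x i) * 1#                    ≈⟨ solve 1 (λ x → x :* :1 :+ (:1 :- x) :* :1
                                        := :1) ≈-refl (x i) ⟩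
      1#                                            ∎
    go i (suc (suc n)) = begin
      (1# - x i) * ((1# - x (suc i)) * p) * e i (2 ℕ.+ n)
        ≈⟨ *-congˡ (e-suc i (suc n)) ⟩
      (1# - x i) * ((1# - x (suc i)) * p) * (s i (suc n) + e (suc i) (suc n))
        ≈⟨ solve 5 (λ u v p s e → u :* (v :* p) :* (s :+ e)
                      := u :* (v :* p :* e) :+ v :* p :* (u :* s)) ≈-refl _ _ p _ _ ⟩
      (1# - x i) * ((1# - x (suc i)) * p * e (suc i) (suc n)) + (1# - x (suc i)) * p * ((1# - x i) * s i (suc n))
        ≈⟨ +-cong (*-congˡ (go (suc i) (suc n))) (*-congˡ ([1-x]s i (suc n))) ⟩
      (1# - x i) * cont (suc i) (suc n) + (1# - x (suc i)) * p * (x i * e (2 ℕ.+ i) n)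
        ≈⟨ +-congˡ (solve 4 (λ v p x e → v :* p :* (x :* e) := x :* v :* (p :* e)) ≈-refl _ p _ _) ⟩
      (1# - x i) * cont (suc i) (suc n) + x i * (1# - x (suc i)) * (p * e (2 ℕ.+ i) n)
        ≈⟨ +-congˡ (*-congˡ (go (2 ℕ.+ i) n)) ⟩
      cont i (2 ℕ.+ n) ∎
      where p = prod (2 ℕ.+ i) n

-- Finite q-Pochhammer products

module Pochhammer {r ℓ} (S : CommutativeRing r ℓ) where

  open CommutativeRing S hiding (zero) renaming (refl to ≈-refl; sym to ≈-sym; trans to ≈-trans)
  open SemiringExp semiring
  open SetoidReasoning setoid
  open IntegerCoefficients S

  rising : Carrier → Carrier → ℕ → Carrier
  rising x y zero    = 1#
  rising x y (suc n) = (1# - x * y ^ n) * rising x y n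

  ^-*2 : ∀ y n → y ^ (n ℕ.* 2) ≈ (y ^ 2) ^ n
  ^-*2 y n = ≈-trans (^-congʳ y (ℕ.*-comm n 2)) (≈-sym (^-assocʳ y 2 n))

  -- Among the factors 1 - x y^i with 1 ≤ i ≤ 2n, the odd exponents go to the first product and the
  -- even ones to the second.
  rising-split : ∀ x y n → rising (x * y) y (n ℕ.* 2) ≈ rising (x * y) (y ^ 2) n * rising (x * y ^ 2) (y ^ 2) n
  rising-split x y zero    = ≈-sym (*-identityˡ _)
  rising-split x y (suc n) = begin
    (1# - x * y * (y * z)) * ((1# - x * y * z) * rising (x * y) y (n ℕ.* 2))
      ≈⟨ *-congˡ (*-congˡ (rising-split x y n)) ⟩
    (1# - x * y * (y * z)) * ((1# - x * y * z) * (f * g))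
      ≈⟨ solve 5 (λ x y z f g → (:1 :- x :* y :* (y :* z)) :* ((:1 :- x :* y :* z) :* (f :* g))
                   := ((:1 :- x :* y :* z) :* f) :* ((:1 :- x :* (y :* (y :* :1)) :* z) :* g)) ≈-refl x y z f g ⟩
    ((1# - x * y * z) * f) * ((1# - x * y ^ 2 * z) * g)
      ≈⟨ *-cong (*-congʳ (+-congˡ (-‿cong (*-congˡ (^-*2 y n))))) (*-congʳ (+-congˡ (-‿cong (*-congˡ (^-*2 y n))))) ⟩
    rising (x * y) (y ^ 2) (suc n) * rising (x * y ^ 2) (y ^ 2) (suc n) ∎
    where
    z = y ^ (n ℕ.* 2)
    f = rising (x * y) (y ^ 2) n
    g = rising (x * y ^ 2) (y ^ 2) n

-- The continuant of the weighted parts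

record Weighting {r ℓ} (S : CommutativeRing r ℓ) (q A C : CommutativeRing.Carrier S)
                 (x : ℕ → CommutativeRing.Carrier S) : Set ℓ where
  open CommutativeRing S
  open SemiringExp semiring
  field
    x-a : ∀ k → x (k ℕ.* 3) ≈ A * q ^ suc k
    x-b : ∀ k → x (1 ℕ.+ k ℕ.* 3) ≈ q ^ suc k
    x-c : ∀ k → x (2 ℕ.+ k ℕ.* 3) ≈ C * q ^ suc k

module WeightedContinuant {r ℓ} (S : CommutativeRing r ℓ) (q A C : CommutativeRing.Carrier S)
                          (x : ℕ → CommutativeRing.Carrier S) (w : Weighting S q A C x) where

  open CommutativeRing S hiding (zero) renaming (refl to ≈-refl; sym to ≈-sym; trans to ≈-trans)
  open SemiringExp semiring
  open SetoidReasoning setoid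
  open IntegerCoefficients S
  open Continuant S x
  open Pochhammer S
  open ClosedForm S q A C
  open Weighting w

  cont₀-snoc : ∀ n {y y′} → x (suc n) ≈ y → x n ≈ y′ →
               cont 0 (2 ℕ.+ n) ≈ (1# - y) * cont 0 (suc n) + y * (1# - y′) * cont 0 n
  cont₀-snoc n {y} {y′} h h′ = ≈-trans (cont-snoc 0 n) (+-cong
    (*-congʳ (+-congˡ (-‿cong xy)))
    (*-congʳ (*-cong xy (+-congˡ (-‿cong xy′)))))
    where
    xy : x (suc (n ℕ.+ 0)) ≈ y
    xy = ≈-trans (reflexive (≡.cong (λ i → x (suc i)) (ℕ.+-identityʳ n))) h
    xy′ : x (n ℕ.+ 0) ≈ y′
    xy′ = ≈-trans (reflexive (≡.cong x (ℕ.+-identityʳ n))) h′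

  -- Each step extends the window on the right by three parts: (k+1)_b leads to `V`, (k+1)_c to
  -- T_{k+1} and (k+2)_a to U_{k+1}.
  cont≈T,U : ∀ k → cont 0 (k ℕ.* 3) ≈ T k × cont 0 (suc (k ℕ.* 3)) ≈ U k
  cont≈T,U zero    = ≈-refl , ≈-refl
  cont≈T,U (suc k) = T≈ , U≈
    where
    Q = q ^ suc k
    V = (1# - Q) * U k + Q * (1# - A * Q) * T k
    W = (1# - C * Q) * V + C * Q * (1# - Q) * U k
    V≈ : cont 0 (2 ℕ.+ k ℕ.* 3) ≈ V
    V≈ = ≈-trans (cont₀-snoc (k ℕ.* 3) (x-b k) (x-a k))
           (+-cong (*-congˡ (proj₂ (cont≈T,U k))) (*-congˡ (proj₁ (cont≈T,U k))))
    W≈ : cont 0 (3 ℕ.+ k ℕ.* 3) ≈ W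
    W≈ = ≈-trans (cont₀-snoc (1 ℕ.+ k ℕ.* 3) (x-c k) (x-b k))
           (+-cong (*-congˡ V≈) (*-congˡ (proj₂ (cont≈T,U k))))
    -- The coefficients of U_k combine as (1 - CQ)(1 - Q) + CQ(1 - Q) = 1 - Q.
    W≈T : W ≈ T (suc k)
    W≈T = solve 5 (λ Q A C U T → (:1 :- C :* Q) :* ((:1 :- Q) :* U :+ Q :* (:1 :- A :* Q) :* T) :+ C :* Q :* (:1 :- Q) :* U
                     := (:1 :- Q) :* U :+ Q :* ((:1 :- A :* Q) :* (:1 :- C :* Q)) :* T)
            ≈-refl Q A C (U k) (T k)
    T≈ = ≈-trans W≈ W≈T
    U≈ : cont 0 (4 ℕ.+ k ℕ.* 3) ≈ U (suc k)
    U≈ = begin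
      cont 0 (4 ℕ.+ k ℕ.* 3)
        ≈⟨ cont₀-snoc (2 ℕ.+ k ℕ.* 3) (x-a (suc k)) (x-c k) ⟩
      (1# - A * (q * Q)) * cont 0 (3 ℕ.+ k ℕ.* 3) + A * (q * Q) * (1# - C * Q) * cont 0 (2 ℕ.+ k ℕ.* 3)
        ≈⟨ +-cong (*-congˡ W≈) (*-congˡ V≈) ⟩
      (1# - A * (q * Q)) * W + A * (q * Q) * (1# - C * Q) * V
        -- Since W - (1 - CQ) V = CQ (1 - Q) U_k, the terms with A combine into one multiple of U_k.
        ≈⟨ solve 6 (λ A C q Q V U → (:1 :- A :* (q :* Q)) :* ((:1 :- C :* Q) :* V :+ C :* Q :* (:1 :- Q) :* U) :+ A :* (q :* Q) :* (:1 :- C :* Q) :* V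
                     := ((:1 :- C :* Q) :* V :+ C :* Q :* (:1 :- Q) :* U) :- A :* C :* (q :* (Q :* Q)) :* (:1 :- Q) :* U)
             ≈-refl A C q Q V (U k) ⟩
      W - A * C * (q * (Q * Q)) * (1# - Q) * U k
        ≈⟨ +-congʳ W≈T ⟩
      U (suc k) ∎

  prod₀-snoc : ∀ n {y} → x n ≈ y → prod 0 (suc n) ≈ (1# - y) * prod 0 n
  prod₀-snoc n h = ≈-trans (prod-snoc 0 n) (*-congʳ (+-congˡ (-‿cong
    (≈-trans (reflexive (≡.cong x (ℕ.+-identityʳ n))) h))))

  prod≈rising : ∀ k → prod 0 (k ℕ.* 3) ≈ rising q q k * (rising (A * q) q k * rising (C * q) q k)
  prod≈rising zero    = solve 0 (:1 := :1 :* (:1 :* :1)) ≈-refl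
  prod≈rising (suc k) = begin
    prod 0 (3 ℕ.+ k ℕ.* 3)
      ≈⟨ ≈-trans (prod₀-snoc (2 ℕ.+ k ℕ.* 3) (x-c k)) (*-congˡ
           (≈-trans (prod₀-snoc (1 ℕ.+ k ℕ.* 3) (x-b k)) (*-congˡ
             (≈-trans (prod₀-snoc (k ℕ.* 3) (x-a k)) (*-congˡ (prod≈rising k)))))) ⟩
    (1# - C * (q * y)) * ((1# - q * y) * ((1# - A * (q * y)) * (f * (g * h))))
      ≈⟨ solve 7 (λ C A q y f g h → (:1 :- C :* (q :* y)) :* ((:1 :- q :* y) :* ((:1 :- A :* (q :* y)) :* (f :* (g :* h))))
                   := ((:1 :- q :* y) :* f) :* (((:1 :- A :* q :* y) :* g) :* ((:1 :- C :* q :* y) :* h)))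
           ≈-refl C A q y f g h ⟩
    rising q q (suc k) * (rising (A * q) q (suc k) * rising (C * q) q (suc k)) ∎
    where
    y = q ^ k
    f = rising q q k
    g = rising (A * q) q k
    h = rising (C * q) q k

  X≈rising : ∀ m → X m ≈ rising (A * q ^ 2) (q ^ 2) m * rising (C * q ^ 2) (q ^ 2) m
  X≈rising zero    = ≈-sym (*-identityˡ _)
  X≈rising (suc m) = begin
    (1# - A * (q * (q * q ^ (m ℕ.* 2)))) * (1# - C * (q * (q * q ^ (m ℕ.* 2)))) * X m
      ≈⟨ *-cong (*-cong (+-congˡ (-‿cong (*-congˡ (*-congˡ (*-congˡ (^-*2 q m))))))
                        (+-congˡ (-‿cong (*-congˡ (*-congˡ (*-congˡ (^-*2 q m)))))))
                (X≈rising m) ⟩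
    (1# - A * (q * (q * y))) * (1# - C * (q * (q * y))) * (f * g)
      ≈⟨ solve 6 (λ A C q y f g → (:1 :- A :* (q :* (q :* y))) :* (:1 :- C :* (q :* (q :* y))) :* (f :* g)
                   := ((:1 :- A :* (q :* (q :* :1)) :* y) :* f) :* ((:1 :- C :* (q :* (q :* :1)) :* y) :* g))
           ≈-refl A C q y f g ⟩
    rising (A * q ^ 2) (q ^ 2) (suc m) * rising (C * q ^ 2) (q ^ 2) (suc m) ∎
    where
    y = (q ^ 2) ^ m
    f = rising (A * q ^ 2) (q ^ 2) m
    g = rising (C * q ^ 2) (q ^ 2) m

  cont≈rising : ∀ k → ∃ λ d → cont 0 (k ℕ.* 3) ≈ rising (A * q ^ 2) (q ^ 2) k * rising (C * q ^ 2) (q ^ 2) k + q ^ k * d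
  cont≈rising k = let d , h = T≈X k in d , ≈-trans (proj₁ (cont≈T,U k)) (≈-trans h (+-congʳ (X≈rising k)))

-- Enumeration of Λ⋆ by smallest part

open DecTotalOrder partOrder using () renaming (_≤_ to _≤ᵖ_; totalOrder to partTotalOrder)

-- `level` and `colour` encode quotient and remainder modulo 3. Recursion in steps of three lets
-- adding 3 to an index raise the size of the part by computation alone.
level : ℕ → ℕ
level (suc (suc (suc i))) = suc (level i)
level _                   = 0

colour : ℕ → Color
colour 0                   = a
colour 1                   = b
colour 2                   = c
colour (suc (suc (suc i))) = colour i

partAt : ℕ → Part
partAt i = part (suc (level i)) (colour i)

index : Part → ℕ
index (part (suc m) x) = m ℕ.* 3 ℕ.+ toℕ (colorRank x)

partAt-index : ∀ p → partAt (index p) ≡ p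
partAt-index (part 1 a) = refl
partAt-index (part 1 b) = refl
partAt-index (part 1 c) = refl
partAt-index (part (suc (suc m)) x) = ≡.cong (λ p → part (suc (size p)) (color p)) (partAt-index (part (suc m) x))

index-partAt : ∀ i → index (partAt i) ≡ i
index-partAt 0                   = refl
index-partAt 1                   = refl
index-partAt 2                   = refl
index-partAt (suc (suc (suc i))) = ≡.cong (3 ℕ.+_) (index-partAt i)

index-< : ∀ m x → m ℕ.* 3 ℕ.+ toℕ (colorRank x) ℕ.< suc m ℕ.* 3
index-< m x = ℕ.<-≤-trans (ℕ.+-monoʳ-< (m ℕ.* 3) (Fin.toℕ<n (colorRank x))) (ℕ.≤-reflexive (ℕ.+-comm (m ℕ.* 3) 3))

index-mono-< : ∀ {m n} x y → m ℕ.< n → m ℕ.* 3 ℕ.+ toℕ (colorRank x) ℕ.< n ℕ.* 3 ℕ.+ toℕ (colorRank y)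
index-mono-< {m} {n} x y m<n = ℕ.<-≤-trans (index-< m x) (ℕ.≤-trans (ℕ.*-monoˡ-≤ 3 m<n) (ℕ.m≤m+n (n ℕ.* 3) _))

≤ᵖ⇒index-≤ : ∀ p r → p ≤ᵖ r → index p ℕ.≤ index r
≤ᵖ⇒index-≤ (part (suc m) x) (part (suc n) y) (inj₁ (m≤n , m≢n)) =
  ℕ.<⇒≤ (index-mono-< x y (ℕ.≤∧≢⇒< (s≤s⁻¹ m≤n) (λ m≡n → m≢n (≡.cong suc m≡n))))
≤ᵖ⇒index-≤ (part (suc m) x) (part (suc .m) y) (inj₂ (refl , x≤y)) = ℕ.+-monoʳ-≤ (m ℕ.* 3) x≤y

index-≤⇒≤ᵖ : ∀ p r → index p ℕ.≤ index r → p ≤ᵖ r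
index-≤⇒≤ᵖ (part (suc m) x) (part (suc n) y) h with ℕ.<-cmp m n
... | tri< m<n m≢n _ = inj₁ (s≤s (ℕ.<⇒≤ m<n) , λ m≡n → m≢n (ℕ.suc-injective m≡n))
... | tri≈ _ refl _  = inj₂ (refl , ℕ.+-cancelˡ-≤ (m ℕ.* 3) _ _ h)
... | tri> _ _ n<m   = contradiction (index-mono-< y x n<m) (ℕ.≤⇒≯ h)

forbidden⇒index : ∀ {p r} → Forbidden p r → index r ≡ suc (index p)
forbidden⇒index (ab (suc m)) = ℕ.+-suc (m ℕ.* 3) 0
forbidden⇒index (bc (suc m)) = ℕ.+-suc (m ℕ.* 3) 1
forbidden⇒index (ca (suc m)) = ≡.trans (≡.cong (3 ℕ.+_) (ℕ.+-identityʳ (m ℕ.* 3))) (≡.cong suc (ℕ.+-comm 2 (m ℕ.* 3)))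

forbidden-partAt : ∀ i → Forbidden (partAt i) (partAt (suc i))
forbidden-partAt 0 = ab 1
forbidden-partAt 1 = bc 1
forbidden-partAt 2 = ca 1
forbidden-partAt (suc (suc (suc i))) = raise (forbidden-partAt i)
  where
  raise : ∀ {m x n y} → Forbidden (part (suc m) x) (part (suc n) y) →
          Forbidden (part (suc (suc m)) x) (part (suc (suc n)) y)
  raise (ab j) = ab (suc j)
  raise (bc j) = bc (suc j)
  raise (ca j) = ca (suc j)

index⇒forbidden : ∀ p r → index r ≡ suc (index p) → Forbidden p r
index⇒forbidden p r h = ≡.subst₂ Forbidden (partAt-index p)
  (≡.trans (≡.cong partAt (≡.sym h)) (partAt-index r)) (forbidden-partAt (index p))

-- Forbidden pairs are exactly the pairs of consecutive indices. In a sorted list this leaves equal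
-- indices or a gap of at least two, so one pairwise relation captures both the order and the
-- exclusions.
Apart : Part → Part → Set
Apart p r = index p ≡ index r ⊎ 2 ℕ.+ index p ℕ.≤ index r

apart⇒≤ : ∀ {p r} → Apart p r → index p ℕ.≤ index r
apart⇒≤ (inj₁ h) = ℕ.≤-reflexive h
apart⇒≤ (inj₂ h) = ℕ.≤-trans (ℕ.m≤n+m _ 2) h

≤∧≢suc⇒apart : ∀ {p r} → index p ℕ.≤ index r → ¬ (index r ≡ suc (index p)) → Apart p r
≤∧≢suc⇒apart {p} {r} h ≢suc with ℕ.m≤n⇒m<n∨m≡n h
... | inj₂ p≡r = inj₁ p≡r
... | inj₁ p<r with ℕ.m≤n⇒m<n∨m≡n p<r
...   | inj₁ 1+p<r = inj₂ 1+p<r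
...   | inj₂ 1+p≡r = contradiction (≡.sym 1+p≡r) ≢suc

apart⇒≢suc : ∀ {p r} → Apart p r ⊎ Apart r p → ¬ (index r ≡ suc (index p))
apart⇒≢suc         (inj₁ (inj₁ p≡r)) h = ℕ.1+n≢n (≡.trans (≡.sym h) (≡.sym p≡r))
apart⇒≢suc         (inj₁ (inj₂ p<r)) h = ℕ.<-irrefl refl (ℕ.≤-trans p<r (ℕ.≤-reflexive h))
apart⇒≢suc {p} {r} (inj₂ r-p)        h = ℕ.<-irrefl refl (ℕ.≤-trans (ℕ.≤-reflexive (≡.sym h)) (apart⇒≤ {r} {p} r-p))

AllPairs-lookup : ∀ {X : Set} {R : X → X → Set} {xs x y} → (∀ {x} → R x x) → AllPairs R xs →
                  x ∈ xs → y ∈ xs → R x y ⊎ R y x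
AllPairs-lookup R-refl _        (here refl) (here refl) = inj₁ R-refl
AllPairs-lookup R-refl (r ∷ _)  (here refl) (there y∈)  = inj₁ (All.lookup r y∈)
AllPairs-lookup R-refl (r ∷ _)  (there x∈)  (here refl) = inj₂ (All.lookup r x∈)
AllPairs-lookup R-refl (_ ∷ rs) (there x∈)  (there y∈)  = AllPairs-lookup R-refl rs x∈ y∈

Λ⋆⇒apart : ∀ {π} → Λ⋆ π → AllPairs Apart π
Λ⋆⇒apart h = go (Sorted⇒AllPairs partTotalOrder (Λ⋆.isPartition h)) (Λ⋆.noForbidden h)
  where
  go : ∀ {π} → AllPairs _≤ᵖ_ π → (∀ {p r} → p ∈ π → r ∈ π → ¬ Forbidden p r) → AllPairs Apart π
  go []       _  = []
  go {p ∷ _} (p≤ ∷ ≤s) nf =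
    All.tabulate (λ {r} r∈ → ≤∧≢suc⇒apart {p} {r} (≤ᵖ⇒index-≤ p r (All.lookup p≤ r∈))
      (λ h → nf (here refl) (there r∈) (index⇒forbidden p r h)))
    ∷ go ≤s (λ p∈ r∈ → nf (there p∈) (there r∈))

apart⇒Λ⋆ : ∀ {π} → AllPairs Apart π → Λ⋆ π
apart⇒Λ⋆ aps = record
  { isPartition = AllPairs⇒Sorted partTotalOrder (AllPairs.map (λ {p} {r} h → index-≤⇒≤ᵖ p r (apart⇒≤ {p} {r} h)) aps)
  ; noForbidden = λ {p} {r} p∈ r∈ f → apart⇒≢suc {p} {r}
      (AllPairs-lookup {R = Apart} (λ {p} → inj₁ (refl {x = index p})) aps p∈ r∈) (forbidden⇒index f)
  }

-- inWindow i n m lists the Apart partitions of m into parts with index in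
-- [i, i + n), and startingAt i n m those in inWindow i (suc n) m with smallest
-- part partAt i.  The argument d of prepend counts down the size of a new part.
mutual
  inWindow : ℕ → ℕ → ℕ → List (List Part)
  inWindow i zero    zero    = [ [] ]
  inWindow i zero    (suc m) = []
  inWindow i (suc n) m       = startingAt i n m ++ inWindow (suc i) n m

  startingAt : ℕ → ℕ → ℕ → List (List Part)
  startingAt i n zero    = []
  startingAt i n (suc m) = prepend (level i) i n m

  prepend : ℕ → ℕ → ℕ → ℕ → List (List Part)
  -- The rest repeats `partAt i` or skips the neighbour i + 1. Above i the window has n indices, so
  -- n - 1 remain from i + 2 on, and none if n = 0.
  prepend zero    i n m       = map (partAt i ∷_) (startingAt i n m ++ inWindow (2 ℕ.+ i) (n ∸ 1) m)
  prepend (suc d) i n zero    = []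
  prepend (suc d) i n (suc m) = prepend d i n m

Above : ℕ → ℕ → List Part → Set
Above i m π = AllPairs Apart π × All (λ p → i ℕ.≤ index p) π × ∣ π ∣ ≡ m

StartsWith : ℕ → List Part → Set
StartsWith i π = ∃ λ π′ → π ≡ partAt i ∷ π′

above-weaken : ∀ {i j m π} → i ℕ.≤ j → Above j m π → Above i m π
above-weaken i≤j (aps , ≤s , eq) = aps , All.map (ℕ.≤-trans i≤j) ≤s , eq

above-cons : ∀ {i m π} → Above i m π → All (Apart (partAt i)) π → Above i (suc (level i) ℕ.+ m) (partAt i ∷ π)
above-cons {i} (aps , ≤s , refl) ap = ap ∷ aps , ℕ.≤-reflexive (≡.sym (index-partAt i)) ∷ ≤s , refl

mutual
  inWindow-sound : ∀ i n m {π} → π ∈ inWindow i n m → Above i m π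
  inWindow-sound i zero    zero (here refl) = [] , [] , refl
  inWindow-sound i (suc n) m    π∈ with ∈-++⁻ (startingAt i n m) π∈
  ... | inj₁ π∈ˢ = proj₂ (startingAt-sound i n m π∈ˢ)
  ... | inj₂ π∈ʷ = above-weaken (ℕ.n≤1+n i) (inWindow-sound (suc i) n m π∈ʷ)

  startingAt-sound : ∀ i n m {π} → π ∈ startingAt i n m → StartsWith i π × Above i m π
  startingAt-sound i n (suc m) π∈ with prepend-sound (level i) i n m π∈
  ... | π′ , m′ , refl , refl , above , ap = (π′ , refl) , above-cons above ap

  prepend-sound : ∀ d i n m {π} → π ∈ prepend d i n m →
                  ∃ λ π′ → ∃ λ m′ → π ≡ partAt i ∷ π′ × m ≡ d ℕ.+ m′ × Above i m′ π′ × All (Apart (partAt i)) π′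
  prepend-sound (suc d) i n (suc m) π∈ =
    let π′ , m′ , π≡ , m≡ , rest = prepend-sound d i n m π∈ in π′ , m′ , π≡ , ≡.cong suc m≡ , rest
  prepend-sound zero    i n m       π∈ with ∈-map⁻ (partAt i ∷_) π∈
  ... | π′ , π′∈ , π≡ with ∈-++⁻ (startingAt i n m) π′∈
  ...   | inj₂ π′∈ʷ = let above@(_ , ≤s , _) = inWindow-sound (2 ℕ.+ i) (n ∸ 1) m π′∈ʷ in
    π′ , m , π≡ , refl , above-weaken (ℕ.m≤n+m i 2) above
      , All.map (λ h → inj₂ (ℕ.≤-trans (ℕ.≤-reflexive (≡.cong (2 ℕ.+_) (index-partAt i))) h)) ≤s
  ...   | inj₁ π′∈ˢ with startingAt-sound i n m π′∈ˢ
  ...     | (π″ , refl) , above@(ap ∷ aps , _) = partAt i ∷ π″ , m , π≡ , refl , above , inj₁ refl ∷ ap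

prepend-complete : ∀ d i n m {π} → π ∈ startingAt i n m ++ inWindow (2 ℕ.+ i) (n ∸ 1) m →
                   partAt i ∷ π ∈ prepend d i n (d ℕ.+ m)
prepend-complete zero    i n m π∈ = ∈-map⁺ (partAt i ∷_) π∈
prepend-complete (suc d) i n m π∈ = prepend-complete d i n m π∈

[]∈inWindow : ∀ i n → [] ∈ inWindow i n 0
[]∈inWindow i zero    = here refl
[]∈inWindow i (suc n) = ∈-++⁺ʳ (startingAt i n 0) ([]∈inWindow (suc i) n)

index≡⇒partAt : ∀ {i p} → i ≡ index p → partAt i ≡ p
index≡⇒partAt {p = p} i≡p = ≡.trans (≡.cong partAt i≡p) (partAt-index p)

mutual
  inWindow-complete : ∀ i n π → AllPairs Apart π → All (λ p → i ℕ.≤ index p) π → All (λ p → index p ℕ.< i ℕ.+ n) π →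
                      π ∈ inWindow i n ∣ π ∣
  inWindow-complete i n       []      _ _ _ = []∈inWindow i n
  inWindow-complete i zero    (p ∷ π) _ (i≤p ∷ _) (p<i ∷ _) =
    contradiction i≤p (ℕ.<⇒≱ (ℕ.<-≤-trans p<i (ℕ.≤-reflexive (ℕ.+-identityʳ i))))
  inWindow-complete i (suc n) (p ∷ π) (ap ∷ aps) (i≤p ∷ _) p<@(_ ∷ π<) =
    [ (λ i<p → ∈-++⁺ʳ (startingAt i n ∣ p ∷ π ∣) (inWindow-complete (suc i) n (p ∷ π) (ap ∷ aps)
        (i<p ∷ All.map (λ {r} h → ℕ.≤-trans i<p (apart⇒≤ {p} {r} h)) ap)
        (All.map (λ h → ℕ.<-≤-trans h (ℕ.≤-reflexive (ℕ.+-suc i n))) p<)))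
    , (λ i≡p → ∈-++⁺ˡ (startingAt-complete i n p π (index≡⇒partAt i≡p) ap aps π<))
    ]′ (ℕ.m≤n⇒m<n∨m≡n i≤p)

  startingAt-complete : ∀ i n p π → partAt i ≡ p → All (Apart p) π → AllPairs Apart π →
                        All (λ r → index r ℕ.< i ℕ.+ suc n) π →
                        p ∷ π ∈ startingAt i n ∣ p ∷ π ∣
  startingAt-complete i n .(partAt i) π refl ap aps π< =
    prepend-complete (level i) i n ∣ π ∣ (tail-complete i n π ap aps π<)

  -- Apartness of the next part from `partAt i` decides between the two sublists: equal indices mean
  -- a repetition, a gap puts the whole tail at i + 2 or above.
  tail-complete : ∀ i n π → All (Apart (partAt i)) π → AllPairs Apart π → All (λ p → index p ℕ.< i ℕ.+ suc n) π →
                  π ∈ startingAt i n ∣ π ∣ ++ inWindow (2 ℕ.+ i) (n ∸ 1) ∣ π ∣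
  tail-complete i n []      _               _          _ = ∈-++⁺ʳ (startingAt i n 0) ([]∈inWindow (2 ℕ.+ i) (n ∸ 1))
  tail-complete i n (r ∷ π) (inj₁ i≡r ∷ _)  (rp ∷ aps) (_ ∷ π<) =
    ∈-++⁺ˡ (startingAt-complete i n r π (index≡⇒partAt (≡.trans (≡.sym (index-partAt i)) i≡r)) rp aps π<)
  tail-complete i n (r ∷ π) (inj₂ i<r ∷ _)  (rp ∷ aps) π< =
    ∈-++⁺ʳ (startingAt i n ∣ r ∷ π ∣) (inWindow-complete (2 ℕ.+ i) (n ∸ 1) (r ∷ π) (rp ∷ aps)
      (2+i≤r ∷ All.map (λ {p} h → ℕ.≤-trans 2+i≤r (apart⇒≤ {r} {p} h)) rp)
      (All.map (λ h → ℕ.<-≤-trans h bound) π<))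
    where
    2+i≤r = ℕ.≤-trans (ℕ.≤-reflexive (≡.cong (2 ℕ.+_) (≡.sym (index-partAt i)))) i<r
    -- An inequality only: at n = 0 the truncated `n ∸ 1` makes the right side larger by one.
    bound : i ℕ.+ suc n ℕ.≤ 2 ℕ.+ i ℕ.+ (n ∸ 1)
    bound = ℕ.≤-trans (ℕ.≤-reflexive (ℕ.+-suc i n))
      (s≤s (ℕ.≤-trans (ℕ.+-monoʳ-≤ i (ℕ.m≤n+m∸n n 1)) (ℕ.≤-reflexive (ℕ.+-suc i (n ∸ 1)))))

-- A common member would begin with `partAt i`, whose index lies below j.
startingAt-disjoint : ∀ {i j n n′ m π} → i ℕ.< j → ¬ (π ∈ startingAt i n m × π ∈ inWindow j n′ m)
startingAt-disjoint {i} {j} {n} {n′} {m} i<j (π∈ˢ , π∈ʷ) with startingAt-sound i n m π∈ˢ | inWindow-sound j n′ m π∈ʷ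
... | (_ , refl) , _ | _ , j≤i ∷ _ , _ = ℕ.<⇒≱ i<j (ℕ.≤-trans j≤i (ℕ.≤-reflexive (index-partAt i)))

mutual
  inWindow-unique : ∀ i n m → Unique (inWindow i n m)
  inWindow-unique i zero    zero    = [] ∷ []
  inWindow-unique i zero    (suc m) = []
  inWindow-unique i (suc n) m       = Unique.++⁺ (startingAt-unique i n m) (inWindow-unique (suc i) n m)
                                        (startingAt-disjoint {n = n} {n} {m} ℕ.≤-refl)

  startingAt-unique : ∀ i n m → Unique (startingAt i n m)
  startingAt-unique i n zero    = []
  startingAt-unique i n (suc m) = prepend-unique (level i) i n m

  prepend-unique : ∀ d i n m → Unique (prepend d i n m)
  prepend-unique zero    i n m       = Unique.map⁺ (λ { refl → refl })
    (Unique.++⁺ (startingAt-unique i n m) (inWindow-unique (2 ℕ.+ i) (n ∸ 1) m)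
      (startingAt-disjoint {n = n} {n ∸ 1} {m} (ℕ.m<n⇒m<1+n (ℕ.n<1+n i))))
  prepend-unique (suc d) i n zero    = []
  prepend-unique (suc d) i n (suc m) = prepend-unique d i n m

index-<-size : ∀ {k} p → size p ℕ.≤ k → index p ℕ.< k ℕ.* 3
index-<-size (part (suc m) x) m<k = ℕ.<-≤-trans (index-< m x) (ℕ.*-monoˡ-≤ 3 m<k)

-- The parts of a partition of m have size at most m ≤ k, so their indices lie below 3k and the
-- window does not cut anything off.
inWindow⇔Λ⋆ : ∀ {k m} → m ℕ.≤ k → ∀ π → π ∈ inWindow 0 (k ℕ.* 3) m ⇔ (Λ⋆ π × ∣ π ∣ ≡ m)
inWindow⇔Λ⋆ {k} {m} m≤k π = mk⇔
  (λ π∈ → let aps , _ , eq = inWindow-sound 0 (k ℕ.* 3) m π∈ in apart⇒Λ⋆ aps , eq)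
  (λ { (h , refl) → inWindow-complete 0 (k ℕ.* 3) π (Λ⋆⇒apart h) (All.universal (λ _ → z≤n) π)
         (All.map (λ {p} s≤ → index-<-size p (ℕ.≤-trans s≤ m≤k)) (sizes≤∣∣ π)) })

-- Generating functions

module GeneratingFunction {r ℓ} (R : CommutativeRing r ℓ) (A C : CommutativeRing.Carrier R) where

  open CommutativeRing R hiding (zero) renaming (refl to ≈-refl; sym to ≈-sym; trans to ≈-trans)
  open SemiringExp semiring using (_^_)
  open PowerSeries R
  open SeriesRing R
  open SetoidReasoning setoid
  open IntegerCoefficients R
  module S = CommutativeRing seriesRing
  open SemiringExp S.semiring using () renaming (_^_ to _^ₛ_)

  weight : List Part → Carrier
  weight π = A ^ #[ a ] π * C ^ #[ c ] π

  colorWeight : Color → Carrier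
  colorWeight a = A
  colorWeight b = 1#
  colorWeight c = C

  weight-∷ : ∀ p π → weight (p ∷ π) ≈ colorWeight (color p) * weight π
  weight-∷ (part _ a) π = *-assoc _ _ _
  weight-∷ (part _ b) π = ≈-sym (*-identityˡ _)
  weight-∷ (part _ c) π = solve 3 (λ x y z → x :* (y :* z) := y :* (x :* z)) ≈-refl _ _ _

  total : List (List Part) → Carrier
  total πs = foldr _+_ 0# (map weight πs)

  total-++ : ∀ πs ρs → total (πs ++ ρs) ≈ total πs + total ρs
  total-++ []       ρs = ≈-sym (+-identityˡ _)
  total-++ (π ∷ πs) ρs = ≈-trans (+-congˡ (total-++ πs ρs)) (≈-sym (+-assoc _ _ _))

  total-∷ : ∀ p πs → total (map (p ∷_) πs) ≈ colorWeight (color p) * total πs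
  total-∷ p []       = ≈-sym (zeroʳ _)
  total-∷ p (π ∷ πs) = ≈-trans (+-cong (weight-∷ p π) (total-∷ p πs)) (≈-sym (distribˡ _ _ _))

  total-↭ : ∀ {πs ρs} → πs ↭ ρs → total πs ≈ total ρs
  total-↭ πs↭ρs = foldr-commMonoid setoid +-isCommutativeMonoid (↭⇒↭ₛ′ isEquivalence (↭.map⁺ weight πs↭ρs))

  windowSeries startSeries : ℕ → ℕ → Series
  windowSeries i n m = total (inWindow i n m)
  startSeries  i n m = total (startingAt i n m)

  -- Two duplicate-free lists with the same members are permutations of each other, and the total
  -- weight is invariant under permutation.
  Λ⋆-series≈window : ∀ {k m} → m ℕ.≤ k → Λ⋆-series A C m ≈ windowSeries 0 (k ℕ.* 3) m
  Λ⋆-series≈window {k} {m} m≤k = total-↭ (∼bag⇒↭ (unique∧set⇒bag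
    (Enumeration.unique (Λ⋆-enumeration m)) (inWindow-unique 0 (k ℕ.* 3) m)
    λ {π} → ⇔-sym (inWindow⇔Λ⋆ m≤k π) ⇔-∘ Enumeration.correct (Λ⋆-enumeration m) π))

  monomial : ℕ → Series
  monomial i = (colorWeight (colour i) · 1ₛ) ⊛ q ^ₛ suc (level i)

  q-⊛-zero : ∀ f → (q ⊛ f) 0 ≈ 0#
  q-⊛-zero f = ≈-trans (+-identityʳ _) (zeroˡ _)

  q-⊛-suc : ∀ f m → (q ⊛ f) (suc m) ≈ f m
  q-⊛-suc f m = begin
    0# * f (suc m) + ((q ∘ suc) ⊛ f) m  ≈⟨ +-cong (zeroˡ _) (⊛-cong q∘suc≋1 (S.refl {f}) m) ⟩
    0# + (1ₛ ⊛ f) m                     ≈⟨ +-identityˡ _ ⟩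
    (1ₛ ⊛ f) m                          ≈⟨ ⊛-identityˡ f m ⟩
    f m                                 ∎
    where
    q∘suc≋1 : q ∘ suc ≋ 1ₛ
    q∘suc≋1 zero    = ≈-refl
    q∘suc≋1 (suc _) = ≈-refl

  startRest : ℕ → ℕ → Series
  startRest i n = colorWeight (colour i) · (startSeries i n ⊕ windowSeries (2 ℕ.+ i) (n ∸ 1))

  -- Each unit counted down by `d` shifts the series by one place, which is multiplication by q.
  prepend-series : ∀ d i n → (λ m → total (prepend d i n m)) ≋ q ^ₛ d ⊛ startRest i n
  prepend-series zero i n m = begin
    total (map (partAt i ∷_) (startingAt i n m ++ inWindow (2 ℕ.+ i) (n ∸ 1) m))
      ≈⟨ total-∷ (partAt i) (startingAt i n m ++ _) ⟩
    colorWeight (colour i) * total (startingAt i n m ++ inWindow (2 ℕ.+ i) (n ∸ 1) m)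
      ≈⟨ *-congˡ (total-++ (startingAt i n m) _) ⟩
    startRest i n m
      ≈⟨ ⊛-identityˡ (startRest i n) m ⟨
    (1ₛ ⊛ startRest i n) m ∎
  prepend-series (suc d) i n zero    =
    ≈-sym (≈-trans (⊛-assoc q (q ^ₛ d) (startRest i n) 0) (q-⊛-zero (q ^ₛ d ⊛ startRest i n)))
  prepend-series (suc d) i n (suc m) = begin
    total (prepend d i n m)                  ≈⟨ prepend-series d i n m ⟩
    (q ^ₛ d ⊛ startRest i n) m               ≈⟨ q-⊛-suc (q ^ₛ d ⊛ startRest i n) m ⟨
    (q ⊛ (q ^ₛ d ⊛ startRest i n)) (suc m)   ≈⟨ ⊛-assoc q (q ^ₛ d) (startRest i n) (suc m) ⟨
    (q ^ₛ suc d ⊛ startRest i n) (suc m)     ∎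

  startSeries-rec : ∀ i n → startSeries i n ≋ monomial i ⊛ (startSeries i n ⊕ windowSeries (2 ℕ.+ i) (n ∸ 1))
  startSeries-rec i n = S.trans shift (S.sym rearrange)
    where
    x = colorWeight (colour i)
    h = startSeries i n ⊕ windowSeries (2 ℕ.+ i) (n ∸ 1)
    Q = q ^ₛ level i
    shift : startSeries i n ≋ q ⊛ (Q ⊛ startRest i n)
    shift zero    = ≈-sym (q-⊛-zero (Q ⊛ startRest i n))
    shift (suc m) = ≈-trans (prepend-series (level i) i n m) (≈-sym (q-⊛-suc (Q ⊛ startRest i n) m))
    rearrange : monomial i ⊛ h ≋ q ⊛ (Q ⊛ startRest i n)
    rearrange = S.trans
      (IntegerCoefficients.solve seriesRing 4 (λ x q Q h → (x ⊗ (q ⊗ Q)) ⊗ h ≔ q ⊗ (Q ⊗ (x ⊗ h))) S.refl (x · 1ₛ) q Q h)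
      (⊛-cong (S.refl {q}) (⊛-cong (S.refl {Q}) (S.trans (·-⊛ x 1ₛ h) (λ m → *-congˡ (⊛-identityˡ h m)))))
      where open IntegerCoefficients seriesRing using () renaming (_:*_ to _⊗_; _:=_ to _≔_)

  windowSeries-zero : ∀ i → windowSeries i 0 ≋ 1ₛ
  windowSeries-zero i zero    = ≈-trans (+-identityʳ _) (*-identityˡ _)
  windowSeries-zero i (suc _) = ≈-refl

  windowSeries-suc : ∀ i n → windowSeries i (suc n) ≋ startSeries i n ⊕ windowSeries (suc i) n
  windowSeries-suc i n m = total-++ (startingAt i n m) _

  level-*3 : ∀ j k → level (k ℕ.* 3 ℕ.+ j) ≡ k ℕ.+ level j
  level-*3 j zero    = refl
  level-*3 j (suc k) = ≡.cong suc (level-*3 j k)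

  colour-*3 : ∀ j k → colour (k ℕ.* 3 ℕ.+ j) ≡ colour j
  colour-*3 j zero    = refl
  colour-*3 j (suc k) = colour-*3 j k

  monomial-*3 : ∀ j → level j ≡ 0 → ∀ k → monomial (j ℕ.+ k ℕ.* 3) ≋ (colorWeight (colour j) · 1ₛ) ⊛ q ^ₛ suc k
  monomial-*3 j j≡0 k = S.reflexive (≡.cong₂ (λ x n → (colorWeight x · 1ₛ) ⊛ q ^ₛ suc n)
    (≡.trans (≡.cong colour (ℕ.+-comm j (k ℕ.* 3))) (colour-*3 j k))
    (≡.trans (≡.cong level (ℕ.+-comm j (k ℕ.* 3)))
      (≡.trans (level-*3 j k) (≡.trans (≡.cong (k ℕ.+_) j≡0) (ℕ.+-identityʳ k)))))

  Aₛ Cₛ : Series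
  Aₛ = A · 1ₛ
  Cₛ = C · 1ₛ

  weighting : Weighting seriesRing q Aₛ Cₛ monomial
  weighting = record
    { x-a = monomial-*3 0 refl
    ; x-b = λ k → S.trans (monomial-*3 1 refl k) (S.trans (·-⊛ 1# 1ₛ (q ^ₛ suc k))
              (λ m → ≈-trans (*-identityˡ _) (⊛-identityˡ (q ^ₛ suc k) m)))
    ; x-c = monomial-*3 2 refl
    }

  open Pochhammer seriesRing using (rising; rising-split)
  open Continuant seriesRing monomial using (prod*≈cont)
  open WeightedContinuant seriesRing q Aₛ Cₛ monomial weighting using (prod≈rising; cont≈rising)

  -- The product formula for parts of size at most k, with the congruence modulo q^k expressed by
  -- the cofactor `d`.
  finite-product : ∀ k → ∃ λ d →
    (rising q q k ⊛ (rising (Aₛ ⊛ q) q k ⊛ rising (Cₛ ⊛ q) q k)) ⊛ windowSeries 0 (k ℕ.* 3)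
      ≋ rising (Aₛ ⊛ q ^ₛ 2) (q ^ₛ 2) k ⊛ rising (Cₛ ⊛ q ^ₛ 2) (q ^ₛ 2) k ⊕ q ^ₛ k ⊛ d
  finite-product k = let d , h = cont≈rising k in d ,
    S.trans (S.*-congʳ {windowSeries 0 (k ℕ.* 3)} (S.sym (prod≈rising k)))
      (S.trans (prod*≈cont startSeries windowSeries windowSeries-zero windowSeries-suc startSeries-rec 0 (k ℕ.* 3)) h)

  -- Agreement up to a power of q and passage to infinite products

  infix 4 _≈[_]_
  _≈[_]_ : Series → ℕ → Series → Set ℓ
  f ≈[ n ] g = ∀ m → m ℕ.≤ n → f m ≈ g m

  ≋⇒≈[] : ∀ {f g n} → f ≋ g → f ≈[ n ] g
  ≋⇒≈[] h m _ = h m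

  ≈[]-sym : ∀ {f g n} → f ≈[ n ] g → g ≈[ n ] f
  ≈[]-sym h m m≤n = ≈-sym (h m m≤n)

  ≈[]-trans : ∀ {f g h n} → f ≈[ n ] g → g ≈[ n ] h → f ≈[ n ] h
  ≈[]-trans f≈g g≈h m m≤n = ≈-trans (f≈g m m≤n) (g≈h m m≤n)

  ⊛-cong-≈[] : ∀ {f f′ g g′ n} → f ≈[ n ] f′ → g ≈[ n ] g′ → f ⊛ g ≈[ n ] f′ ⊛ g′
  ⊛-cong-≈[] f≈ g≈ m m≤n = ⊛-cong-≤ m (λ i i≤m → f≈ i (ℕ.≤-trans i≤m m≤n)) (λ i i≤m → g≈ i (ℕ.≤-trans i≤m m≤n))

  ↑≋^ : ∀ f k → f ↑ k ≋ f ^ₛ k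
  ↑≋^ f zero    = S.refl {1ₛ}
  ↑≋^ f (suc k) = ⊛-cong (S.refl {f}) (↑≋^ f k)

  poch-cong : ∀ {x x′ y y′} → x ≋ x′ → y ≋ y′ → ∀ n → poch x y n ≋ rising x′ y′ n
  poch-cong         x≋ y≋ zero    = S.refl {1ₛ}
  poch-cong {y = y} x≋ y≋ (suc n) = ⊛-cong
    (S.+-congˡ {1ₛ} (S.-‿cong (⊛-cong x≋ (S.trans (↑≋^ y n) (SemiringExp.^-congˡ S.semiring n y≋)))))
    (poch-cong x≋ y≋ n)

  poch-zero : ∀ x y n → x 0 ≈ 0# → poch x y n 0 ≈ 1#
  poch-zero x y zero    x₀ = ≈-refl
  poch-zero x y (suc n) x₀ = begin
    (1# - (x 0 * (y ↑ n) 0 + 0#)) * poch x y n 0 + 0#  ≈⟨ +-congʳ (*-cong (+-congˡ (-‿cong (+-congʳ (*-congʳ x₀)))) (poch-zero x y n x₀)) ⟩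
    (1# - (0# * (y ↑ n) 0 + 0#)) * 1# + 0#
      ≈⟨ solve 1 (λ u → (:1 :- (con (+ 0) :* u :+ con (+ 0))) :* :1 :+ con (+ 0) := :1) ≈-refl _ ⟩
    1#                                                 ∎

  poch≈∞ : ∀ x {y} → y 0 ≈ 0# → ∀ {n k} → n ℕ.< k → poch x y k ≈[ n ] ⟨ x ⨾ y ⟩∞
  poch≈∞ x y₀ n<k m m≤n = poch-limit x y₀ (ℕ.≤-<-trans m≤n n<k)

  q↑2-zero : (q ↑ 2) 0 ≈ 0#
  q↑2-zero = q-⊛-zero (q ↑ 1)

  ·q≋ : ∀ x → x · q ≋ (x · 1ₛ) ⊛ q
  ·q≋ x m = ≈-sym (≈-trans (·-⊛ x 1ₛ q m) (*-congˡ (⊛-identityˡ q m)))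

  rising-even : ∀ x n → rising ((x · 1ₛ) ⊛ q ^ₛ 2) (q ^ₛ 2) n ≋ poch (x · q ↑ 2) (q ↑ 2) n
  rising-even x n = S.sym (poch-cong (λ m → ≈-sym (≈-trans (·-⊛ x 1ₛ (q ^ₛ 2) m)
    (*-congˡ (≈-trans (⊛-identityˡ (q ^ₛ 2) m) (≈-sym (↑≋^ q 2 m))))))
                             (↑≋^ q 2) n)

  ∞-split : ∀ x → ⟨ x · q ⨾ q ⟩∞ ≋ ⟨ x · q ⨾ q ↑ 2 ⟩∞ ⊛ ⟨ x · q ↑ 2 ⨾ q ↑ 2 ⟩∞
  ∞-split x n = begin
    ⟨ x · q ⨾ q ⟩∞ n
      -- Any number of factors above n gives the coefficient of qⁿ; an even number is chosen so that
      -- `rising-split` applies.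
      ≈⟨ poch-limit (x · q) ≈-refl {N = k ℕ.* 2} (ℕ.m≤m*n k 2) ⟨
    poch (x · q) q (k ℕ.* 2) n
      ≈⟨ poch-cong (·q≋ x) (S.refl {q}) (k ℕ.* 2) n ⟩
    rising ((x · 1ₛ) ⊛ q) q (k ℕ.* 2) n
      ≈⟨ rising-split (x · 1ₛ) q k n ⟩
    (rising ((x · 1ₛ) ⊛ q) (q ^ₛ 2) k ⊛ rising ((x · 1ₛ) ⊛ q ^ₛ 2) (q ^ₛ 2) k) n
      ≈⟨ ⊛-cong (poch-cong (·q≋ x) (↑≋^ q 2) k) (S.sym (rising-even x k)) n ⟨
    (poch (x · q) (q ↑ 2) k ⊛ poch (x · q ↑ 2) (q ↑ 2) k) n
      ≈⟨ ⊛-cong-≈[] (poch≈∞ (x · q) q↑2-zero ℕ.≤-refl) (poch≈∞ (x · q ↑ 2) q↑2-zero ℕ.≤-refl) n ℕ.≤-refl ⟩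
    (⟨ x · q ⨾ q ↑ 2 ⟩∞ ⊛ ⟨ x · q ↑ 2 ⨾ q ↑ 2 ⟩∞) n ∎
    where k = suc n

  even : Series
  even = ⟨ A · q ↑ 2 ⨾ q ↑ 2 ⟩∞ ⊛ ⟨ C · q ↑ 2 ⨾ q ↑ 2 ⟩∞

  -- For the coefficient of qⁿ it suffices to take k = n + 1: products of k factors and partitions
  -- into parts of size at most k are exact up to qⁿ, and the error term begins at q^{n+1}.
  Λ⋆-product : (⟨ q ⨾ q ⟩∞ ⊛ (⟨ A · q ⨾ q ⟩∞ ⊛ ⟨ C · q ⨾ q ⟩∞)) ⊛ Λ⋆-series A C ≋ even
  Λ⋆-product n = begin
    ((⟨ q ⨾ q ⟩∞ ⊛ (⟨ A · q ⨾ q ⟩∞ ⊛ ⟨ C · q ⨾ q ⟩∞)) ⊛ Λ⋆-series A C) n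
      ≈⟨ ⊛-cong-≈[] {g = Λ⋆-series A C} {g′ = windowSeries 0 (k ℕ.* 3)}
           (⊛-cong-≈[] (factor q S.refl) (⊛-cong-≈[] (factor (A · q) (·q≋ A)) (factor (C · q) (·q≋ C))))
           (λ m m≤n → Λ⋆-series≈window (ℕ.m≤n⇒m≤1+n m≤n)) n ℕ.≤-refl ⟩
    ((rising q q k ⊛ (rising (Aₛ ⊛ q) q k ⊛ rising (Cₛ ⊛ q) q k)) ⊛ windowSeries 0 (k ℕ.* 3)) n
      ≈⟨ proj₂ (finite-product k) n ⟩
    (rising (Aₛ ⊛ q ^ₛ 2) (q ^ₛ 2) k ⊛ rising (Cₛ ⊛ q ^ₛ 2) (q ^ₛ 2) k) n + (q ^ₛ k ⊛ d) n
      ≈⟨ +-cong (⊛-cong (rising-even A k) (rising-even C k) n) vanish ⟩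
    (poch (A · q ↑ 2) (q ↑ 2) k ⊛ poch (C · q ↑ 2) (q ↑ 2) k) n + 0#
      ≈⟨ +-identityʳ _ ⟩
    (poch (A · q ↑ 2) (q ↑ 2) k ⊛ poch (C · q ↑ 2) (q ↑ 2) k) n
      ≈⟨ ⊛-cong-≈[] (poch≈∞ (A · q ↑ 2) q↑2-zero ℕ.≤-refl) (poch≈∞ (C · q ↑ 2) q↑2-zero ℕ.≤-refl) n ℕ.≤-refl ⟩
    even n ∎
    where
    k = suc n
    d = proj₁ (finite-product k)
    factor : ∀ x {x′} → x ≋ x′ → ⟨ x ⨾ q ⟩∞ ≈[ n ] rising x′ q k
    factor x x≋ = ≈[]-trans (≈[]-sym (poch≈∞ x ≈-refl ℕ.≤-refl)) (≋⇒≈[] (poch-cong x≋ (S.refl {q}) k))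
    vanish : (q ^ₛ k ⊛ d) n ≈ 0#
    vanish = ≈-trans (⊛-comm (q ^ₛ k) d n)
      (⊛-vanish d (q ^ₛ k) k (λ m m<k → ≈-trans (≈-sym (↑≋^ q k m)) (↑-vanish q ≈-refl k m m<k)) n ℕ.≤-refl)

  -- Cancellation of the even factors

  denominator : Series
  denominator = ⟨ q ⨾ q ⟩∞ ⊛ ⟨ A · q ⨾ q ↑ 2 ⟩∞ ⊛ ⟨ C · q ⨾ q ↑ 2 ⟩∞

  ⊛-unit₀ : ∀ f g → f 0 ≈ 1# → g 0 ≈ 1# → (f ⊛ g) 0 ≈ 1#
  ⊛-unit₀ f g f₀ g₀ = ≈-trans (+-identityʳ _) (≈-trans (*-cong f₀ g₀) (*-identityˡ _))

  ∞-unit₀ : ∀ x y → x 0 ≈ 0# → ⟨ x ⨾ y ⟩∞ 0 ≈ 1#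
  ∞-unit₀ x y = poch-zero x y 1

  open IntegerCoefficients seriesRing using () renaming (solve to solveₛ; _:*_ to _⊗_; _:=_ to _≔_)

  -- By `∞-split`, multiplying by `even` completes the products over odd powers to those of
  -- `Λ⋆-product`, whose value is again `even`. Its constant term is 1, so it is invertible and
  -- cancels.
  denominator⊛Λ⋆ : denominator ⊛ Λ⋆-series A C ≋ 1ₛ
  denominator⊛Λ⋆ = S.trans
      (S.sym (S.trans (S.*-congʳ {denominator ⊛ Λ} (1/-inverse even even₀)) (S.*-identityˡ _)))
      (S.trans (solveₛ 3 (λ e i x → (e ⊗ i) ⊗ x ≔ (e ⊗ x) ⊗ i) S.refl even (1/ even) (denominator ⊛ Λ))
        (S.trans (S.*-congʳ {1/ even} absorb) (1/-inverse even even₀)))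
    where
    Λ = Λ⋆-series A C
    even₀ : even 0 ≈ 1#
    even₀ = ⊛-unit₀ ⟨ A · q ↑ 2 ⨾ q ↑ 2 ⟩∞ ⟨ C · q ↑ 2 ⨾ q ↑ 2 ⟩∞
              (∞-unit₀ (A · q ↑ 2) (q ↑ 2) (≈-trans (*-congˡ q↑2-zero) (zeroʳ _)))
              (∞-unit₀ (C · q ↑ 2) (q ↑ 2) (≈-trans (*-congˡ q↑2-zero) (zeroʳ _)))
    absorb : even ⊛ (denominator ⊛ Λ) ≋ even
    absorb = S.trans
      (solveₛ 6 (λ p a₁ a₂ c₁ c₂ l → (a₂ ⊗ c₂) ⊗ (((p ⊗ a₁) ⊗ c₁) ⊗ l) ≔ (p ⊗ ((a₁ ⊗ a₂) ⊗ (c₁ ⊗ c₂))) ⊗ l) S.refl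
        ⟨ q ⨾ q ⟩∞ ⟨ A · q ⨾ q ↑ 2 ⟩∞ ⟨ A · q ↑ 2 ⨾ q ↑ 2 ⟩∞ ⟨ C · q ⨾ q ↑ 2 ⟩∞ ⟨ C · q ↑ 2 ⨾ q ↑ 2 ⟩∞ Λ)
      (S.trans (S.*-congʳ {Λ} (S.*-congˡ {⟨ q ⨾ q ⟩∞} (⊛-cong (S.sym (∞-split A)) (S.sym (∞-split C))))) Λ⋆-product)

  -- Uniqueness of inverses: `denominator` has constant term 1, so `1/ denominator` is an inverse of
  -- it as well.
  Λ⋆≋1/denominator : Λ⋆-series A C ≋ 1/ denominator
  Λ⋆≋1/denominator = S.trans (S.sym (S.trans (S.*-congʳ {Λ} (1/-inverse denominator d₀)) (S.*-identityˡ Λ)))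
    (S.trans (solveₛ 3 (λ d i l → (d ⊗ i) ⊗ l ≔ (d ⊗ l) ⊗ i) S.refl denominator (1/ denominator) Λ)
      (S.trans (S.*-congʳ {1/ denominator} denominator⊛Λ⋆) (S.*-identityˡ _)))
    where
    Λ = Λ⋆-series A C
    d₀ : denominator 0 ≈ 1#
    d₀ = ⊛-unit₀ (⟨ q ⨾ q ⟩∞ ⊛ ⟨ A · q ⨾ q ↑ 2 ⟩∞) ⟨ C · q ⨾ q ↑ 2 ⟩∞
           (⊛-unit₀ ⟨ q ⨾ q ⟩∞ ⟨ A · q ⨾ q ↑ 2 ⟩∞ (∞-unit₀ q q ≈-refl) (∞-unit₀ (A · q) (q ↑ 2) (zeroʳ A)))
           (∞-unit₀ (C · q) (q ↑ 2) (zeroʳ C))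

theorem3p2 : ∀ {r ℓ} (R : CommutativeRing r ℓ) (A C : CommutativeRing.Carrier R) →
    let open PowerSeries R in
    Λ⋆-series A C ≋ 1/ (⟨ q ⨾ q ⟩∞ ⊛ ⟨ A · q ⨾ q ↑ 2 ⟩∞ ⊛ ⟨ C · q ⨾ q ↑ 2 ⟩∞)
theorem3p2 R A C = GeneratingFunction.Λ⋆≋1/denominator R A C
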